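{- For every $d\ge 10$, the $d$-dimensional hypercube contains vertex sets $A$ and $B$ such that, when $\mu_A$ and $\mu_B$ are the uniform probability measures with support $A$ and $B$ respectively, there exists an optimal transportation $\tau:A\times B\to\mathbb{R}_{\ge 0}$ from $\mu_A$ to $\mu_B$ such that the entropy of the probability distribution $$\mu_C(\gamma)=\sum_{\alpha\in A,\ \beta\in B,\ \gamma\in\widehat{m}(\alpha,\beta)}\frac{\tau(\alpha,\beta)}{|\widehat{m}(\alpha,\beta)|}$$ is less than the average of the entropies of $\mu_A$ and $\mu_B$.
   Context: The $d$-dimensional hypercube has vertex set $\{0,1\}^d$ with the Hamming distance $d(\cdot,\cdot)$. The symmetric discrete midpoints are $$\widehat{m}(a,b)=\{u: d(a,u)=\lfloor d(a,b)/2\rfloor,\ d(a,u)+d(u,b)=d(a,b)\}\cup\{u: d(a,u)=\lceil d(a,b)/2\rceil,\ d(a,u)+d(u,b)=d(a,b)\}.$$ A transportation from $\mu_A$ to $\mu_B$ is a nonnegative function $\tau$ with $\mu_A(\alpha)=\sum_\beta\tau(\alpha,\beta)$ and $\mu_B(\beta)=\sum_\alpha\tau(\alpha,\beta)$. It is optimal if it minimizes $W^2(\tau)=\sum_{\alpha,\beta}\tau(\alpha,\beta)d(\alpha,\beta)^2$ among all transportations from $\mu_A$ to $\mu_B$. The entropy of a probability distribution $\mu$ is $\sum_y\mu(y)\ln(1/\mu(y))$. -}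

module Defs where

import Algebra.Definitions.RawSemiring
open import Data.Bool.Base using (Bool; true; false; if_then_else_; _xor_)
import Data.Bool.Properties as Bool
open import Data.Integer.Base as ℤ using (+_; +[1+_]; -[1+_]; +0)
import Data.Integer.Properties as ℤ
open import Data.List.Base using (List; []; _∷_; _++_; map; filter; foldr; length)
open import Data.List.Membership.Propositional using (_∈_)
import Data.List.Membership.DecPropositional as DecMembership
open import Data.List.Relation.Unary.Any using (here; there)
open import Data.List.Relation.Unary.Unique.Propositional using (Unique)
open import Data.Nat.Base as ℕ using (ℕ; zero; suc; ⌊_/2⌋; ⌈_/2⌉)
import Data.Nat.Properties as ℕ
open import Data.Product.Base using (Σ; ∃; ∃-syntax; _×_; _,_; proj₁; proj₂)
open import Data.Rational.Base
import Data.Rational.Properties as ℚ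
import Data.Rational.Unnormalised.Base as ℚᵘ
import Data.Rational.Unnormalised.Properties as ℚᵘ
open import Data.Rational.Solver using (module +-*-Solver)
open import Data.Sum.Base using (_⊎_; inj₁; inj₂)
open import Data.Vec.Base using (Vec; []; _∷_)
open import Data.Vec.Properties using (≡-dec)
open import Relation.Binary.PropositionalEquality
  using (_≡_; _≢_; refl; sym; trans; cong; cong₂; subst)
open import Relation.Nullary using (yes; no; contradiction)
open import Relation.Nullary.Decidable using (_×-dec_; _⊎-dec_)
open import Relation.Unary using (Pred; Decidable)
open import Level using (0ℓ)

open Algebra.Definitions.RawSemiring +-*-rawSemiring public using (_^_)

------------------------------------------------------------------------
-- Rational arithmetic

-- Total reciprocal with recip 0 = 0, so that inversion of reals can act on
-- every term of a sequence.
recip : ℚ → ℚ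
recip p with p ℚ.≟ 0ℚ
... | yes _  = 0ℚ
... | no p≢0 = 1/_ p {{≢-nonZero p≢0}}

private
  open +-*-Solver using (solve; con; _:=_; _:+_; _:*_; _:-_; :-_)
  open ℚ.≤-Reasoning

  *-monoˡ : ∀ {p q r} → 0ℚ ≤ r → p ≤ q → r * p ≤ r * q
  *-monoˡ {r = r} 0≤r = ℚ.*-monoˡ-≤-nonNeg r {{nonNegative 0≤r}}

  *-monoʳ : ∀ {p q r} → 0ℚ ≤ r → p ≤ q → p * r ≤ q * r
  *-monoʳ {r = r} 0≤r = ℚ.*-monoʳ-≤-nonNeg r {{nonNegative 0≤r}}

  *-mono : ∀ {p q r s} → 0ℚ ≤ r → 0ℚ ≤ q → p ≤ q → r ≤ s → p * r ≤ q * s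
  *-mono 0≤r 0≤q p≤q r≤s = ℚ.≤-trans (*-monoʳ 0≤r p≤q) (*-monoˡ 0≤q r≤s)

  *-pos : ∀ {p q} → 0ℚ < p → 0ℚ < q → 0ℚ < p * q
  *-pos {p} {q} 0<p 0<q =
    ℚ.positive⁻¹ (p * q) {{ℚ.pos*pos⇒pos p {{positive 0<p}} q {{positive 0<q}}}}

  *-nonNeg : ∀ {p q} → 0ℚ ≤ p → 0ℚ ≤ q → 0ℚ ≤ p * q
  *-nonNeg {p} {q} 0≤p 0≤q = ℚ.nonNegative⁻¹ (p * q)
    {{ℚ.nonNeg*nonNeg⇒nonNeg p {{nonNegative 0≤p}} q {{nonNegative 0≤q}}}}

  +-nonNeg : ∀ {p q} → 0ℚ ≤ p → 0ℚ ≤ q → 0ℚ ≤ p + q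
  +-nonNeg 0≤p 0≤q = ℚ.+-mono-≤ 0≤p 0≤q

  +-pos-nonNeg : ∀ {p q} → 0ℚ < p → 0ℚ ≤ q → 0ℚ < p + q
  +-pos-nonNeg 0<p 0≤q = ℚ.+-mono-<-≤ 0<p 0≤q

  0<1 : 0ℚ < 1ℚ
  0<1 = ℚ.positive⁻¹ 1ℚ

  0≤1 : 0ℚ ≤ 1ℚ
  0≤1 = ℚ.<⇒≤ 0<1

  p≤p+nonNeg : ∀ {p q} → 0ℚ ≤ q → p ≤ p + q
  p≤p+nonNeg {p} {q} 0≤q =
    subst (_≤ p + q) (ℚ.+-identityʳ p) (ℚ.+-monoʳ-≤ p 0≤q)

  ∣∣-comm : ∀ p q → ∣ p - q ∣ ≡ ∣ q - p ∣
  ∣∣-comm p q = trans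
    (cong ∣_∣ (solve 2 (λ x y → x :- y := :- (y :- x)) refl p q))
    (ℚ.∣-p∣≡∣p∣ (q - p))

  ∣∣-bound : ∀ {p b} → p ≤ b → - p ≤ b → ∣ p ∣ ≤ b
  ∣∣-bound {p} p≤b -p≤b with ℚ.∣p∣≡p∨∣p∣≡-p p
  ... | inj₁ e = ℚ.≤-trans (ℚ.≤-reflexive e) p≤b
  ... | inj₂ e = ℚ.≤-trans (ℚ.≤-reflexive e) -p≤b

  p≤∣p∣ : ∀ p → p ≤ ∣ p ∣
  p≤∣p∣ p with ℚ.≤-total 0ℚ p
  ... | inj₁ 0≤p = ℚ.≤-reflexive (sym (ℚ.0≤p⇒∣p∣≡p 0≤p))
  ... | inj₂ p≤0 = ℚ.≤-trans p≤0 (ℚ.0≤∣p∣ p)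

  recip-* : ∀ {p} → 0ℚ < p → recip p * p ≡ 1ℚ
  recip-* {p} 0<p with p ℚ.≟ 0ℚ
  ... | yes p≡0 = contradiction (sym p≡0) (ℚ.<⇒≢ 0<p)
  ... | no p≢0 = ℚ.*-inverseˡ p {{≢-nonZero p≢0}}

  recip-pos : ∀ {p} → 0ℚ < p → 0ℚ < recip p
  recip-pos {p} 0<p with p ℚ.≟ 0ℚ
  ... | yes p≡0 = contradiction (sym p≡0) (ℚ.<⇒≢ 0<p)
  ... | no p≢0 = ℚ.positive⁻¹ (1/_ p {{≢-nonZero p≢0}})
                   {{ℚ.1/pos⇒pos p {{positive 0<p}}}}

  recip-anti : ∀ {p q} → 0ℚ < p → p ≤ q → recip q ≤ recip p
  recip-anti {p} {q} 0<p p≤q = begin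
    recip q                 ≡⟨ ℚ.*-identityʳ (recip q) ⟨
    recip q * 1ℚ            ≡⟨ cong (recip q *_) (recip-* 0<p) ⟨
    recip q * (recip p * p) ≤⟨ *-monoˡ (ℚ.<⇒≤ (recip-pos 0<q))
                                 (*-monoˡ (ℚ.<⇒≤ (recip-pos 0<p)) p≤q) ⟩
    recip q * (recip p * q) ≡⟨ solve 3 (λ a b c → a :* (b :* c) := (a :* c) :* b)
                                 refl (recip q) (recip p) q ⟩
    (recip q * q) * recip p ≡⟨ cong (_* recip p) (recip-* 0<q) ⟩
    1ℚ * recip p            ≡⟨ ℚ.*-identityˡ (recip p) ⟩
    recip p                 ∎
    where
    0<q : 0ℚ < q
    0<q = ℚ.<-≤-trans 0<p p≤q

  -- Division by 2C, used to choose ε' with C * (ε' + ε') ≤ ε.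
  halve : ∀ {ε} C → 0ℚ < ε → 0ℚ < C →
          ∃[ δ ] (0ℚ < δ × C * (δ + δ) ≡ ε)
  halve {ε} C 0<ε 0<C = ε * r , *-pos 0<ε (recip-pos 0<2C) , eq
    where
    r : ℚ
    r = recip (C + C)
    0<2C : 0ℚ < C + C
    0<2C = +-pos-nonNeg 0<C (ℚ.<⇒≤ 0<C)
    eq : C * (ε * r + ε * r) ≡ ε
    eq = begin-equality
      C * (ε * r + ε * r) ≡⟨ solve 3 (λ c e s → c :* (e :* s :+ e :* s)
                               := (s :* (c :+ c)) :* e) refl C ε r ⟩
      (r * (C + C)) * ε   ≡⟨ cong (_* ε) (recip-* 0<2C) ⟩
      1ℚ * ε              ≡⟨ ℚ.*-identityˡ ε ⟩
      ε                   ∎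

------------------------------------------------------------------------
-- Real numbers: Cauchy sequences of rationals.  The existential in Cauchy
-- is a Σ-type, so every real carries a modulus of convergence.

Cauchy : (ℕ → ℚ) → Set
Cauchy s = ∀ ε → 0ℚ < ε →
  ∃[ N ] (∀ m n → N ℕ.≤ m → N ℕ.≤ n → ∣ s m - s n ∣ ≤ ε)

record ℝ : Set where
  constructor mkℝ
  field
    seq    : ℕ → ℚ
    cauchy : Cauchy seq
open ℝ public

infix  4 _≤ℝ_ _<ℝ_ _≃ℝ_
infixl 6 _+ℝ_ _-ℝ_
infixl 7 _*ℝ_

_≤ℝ_ : ℝ → ℝ → Set
x ≤ℝ y = ∀ ε → 0ℚ < ε → ∃[ N ] (∀ n → N ℕ.≤ n → seq x n ≤ seq y n + ε)

_<ℝ_ : ℝ → ℝ → Set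
x <ℝ y = ∃[ ε ] (0ℚ < ε × ∃[ N ] (∀ n → N ℕ.≤ n → seq x n + ε ≤ seq y n))

_≃ℝ_ : ℝ → ℝ → Set
x ≃ℝ y = x ≤ℝ y × y ≤ℝ x

private
  abstract
    lipschitz : ∀ (s t u : ℕ → ℚ) C → 0ℚ < C → ∀ N →
      (∀ m n → N ℕ.≤ m → N ℕ.≤ n →
         ∣ u m - u n ∣ ≤ C * (∣ s m - s n ∣ + ∣ t m - t n ∣)) →
      Cauchy s → Cauchy t → Cauchy u
    lipschitz s t u C 0<C N lip cs ct ε 0<ε = go (halve C 0<ε 0<C)
      where
      go : ∃[ δ ] (0ℚ < δ × C * (δ + δ) ≡ ε) →
           ∃[ M ] (∀ m n → M ℕ.≤ m → M ℕ.≤ n → ∣ u m - u n ∣ ≤ ε)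
      go (δ , 0<δ , eq) = N ℕ.⊔ (N₁ ℕ.⊔ N₂) , bound
        where
        N₁ N₂ : ℕ
        N₁ = proj₁ (cs δ 0<δ)
        N₂ = proj₁ (ct δ 0<δ)
        left : ∀ {k} → N ℕ.⊔ (N₁ ℕ.⊔ N₂) ℕ.≤ k → N₁ ℕ.≤ k
        left h = ℕ.m⊔n≤o⇒m≤o N₁ N₂ (ℕ.m⊔n≤o⇒n≤o N (N₁ ℕ.⊔ N₂) h)
        right : ∀ {k} → N ℕ.⊔ (N₁ ℕ.⊔ N₂) ℕ.≤ k → N₂ ℕ.≤ k
        right h = ℕ.m⊔n≤o⇒n≤o N₁ N₂ (ℕ.m⊔n≤o⇒n≤o N (N₁ ℕ.⊔ N₂) h)
        bound : ∀ m n → N ℕ.⊔ (N₁ ℕ.⊔ N₂) ℕ.≤ m → N ℕ.⊔ (N₁ ℕ.⊔ N₂) ℕ.≤ n →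
                ∣ u m - u n ∣ ≤ ε
        bound m n ≤m ≤n = begin
          ∣ u m - u n ∣
            ≤⟨ lip m n (ℕ.m⊔n≤o⇒m≤o N _ ≤m) (ℕ.m⊔n≤o⇒m≤o N _ ≤n) ⟩
          C * (∣ s m - s n ∣ + ∣ t m - t n ∣)
            ≤⟨ *-monoˡ (ℚ.<⇒≤ 0<C) (ℚ.+-mono-≤
                 (proj₂ (cs δ 0<δ) m n (left ≤m) (left ≤n))
                 (proj₂ (ct δ 0<δ) m n (right ≤m) (right ≤n))) ⟩
          C * (δ + δ)
            ≡⟨ eq ⟩
          ε ∎

    bounded : ∀ x → ∃[ K ] (0ℚ < K × ∃[ N ] (∀ n → N ℕ.≤ n → ∣ seq x n ∣ ≤ K))
    bounded x with cauchy x 1ℚ 0<1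
    ... | N , h = 1ℚ + ∣ seq x N ∣ , +-pos-nonNeg 0<1 (ℚ.0≤∣p∣ (seq x N)) , N ,
      λ n N≤n → begin
        ∣ seq x n ∣
          ≡⟨ cong ∣_∣ (solve 2 (λ a b → a := (a :- b) :+ b) refl (seq x n) (seq x N)) ⟩
        ∣ (seq x n - seq x N) + seq x N ∣
          ≤⟨ ℚ.∣p+q∣≤∣p∣+∣q∣ (seq x n - seq x N) (seq x N) ⟩
        ∣ seq x n - seq x N ∣ + ∣ seq x N ∣
          ≤⟨ ℚ.+-monoˡ-≤ ∣ seq x N ∣ (h n N N≤n ℕ.≤-refl) ⟩
        1ℚ + ∣ seq x N ∣ ∎

private
  abstract
    const-cauchy : ∀ q → Cauchy (λ _ → q)
    const-cauchy q ε 0<ε = 0 , λ _ _ _ _ →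
      ℚ.≤-trans (ℚ.≤-reflexive (cong ∣_∣ (ℚ.+-inverseʳ q))) (ℚ.<⇒≤ 0<ε)

fromℚ : ℚ → ℝ
fromℚ q = mkℝ (λ _ → q) (const-cauchy q)

fromℕ : ℕ → ℝ
fromℕ n = fromℚ (+ n / 1)

0ℝ 1ℝ : ℝ
0ℝ = fromℚ 0ℚ
1ℝ = fromℚ 1ℚ

private
  abstract
    +-cauchy : ∀ (s t : ℕ → ℚ) → Cauchy s → Cauchy t → Cauchy (λ n → s n + t n)
    +-cauchy s t = lipschitz s t (λ n → s n + t n) 1ℚ 0<1 0
      λ m n _ _ → step (s m) (t m) (s n) (t n)
      where
      step : ∀ a b c d → ∣ (a + b) - (c + d) ∣ ≤ 1ℚ * (∣ a - c ∣ + ∣ b - d ∣)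
      step a b c d = begin
        ∣ (a + b) - (c + d) ∣
          ≡⟨ cong ∣_∣ (solve 4 (λ a b c d → (a :+ b) :- (c :+ d)
               := (a :- c) :+ (b :- d)) refl a b c d) ⟩
        ∣ (a - c) + (b - d) ∣
          ≤⟨ ℚ.∣p+q∣≤∣p∣+∣q∣ (a - c) (b - d) ⟩
        ∣ a - c ∣ + ∣ b - d ∣
          ≡⟨ ℚ.*-identityˡ _ ⟨
        1ℚ * (∣ a - c ∣ + ∣ b - d ∣) ∎

_+ℝ_ : ℝ → ℝ → ℝ
x +ℝ y = mkℝ (λ n → seq x n + seq y n) (+-cauchy (seq x) (seq y) (cauchy x) (cauchy y))

private
  abstract
    *-cauchy : ∀ (s t : ℕ → ℚ) {K L} → 0ℚ < K → 0ℚ < L → ∀ N M →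
      (∀ n → N ℕ.≤ n → ∣ s n ∣ ≤ K) → (∀ n → M ℕ.≤ n → ∣ t n ∣ ≤ L) →
      Cauchy s → Cauchy t → Cauchy (λ n → s n * t n)
    *-cauchy s t {K} {L} 0<K 0<L N M hs ht =
      lipschitz s t (λ n → s n * t n) (K + L) (+-pos-nonNeg 0<K (ℚ.<⇒≤ 0<L)) (N ℕ.⊔ M)
        λ m n ≤m ≤n → step (s m) (t m) (s n) (t n)
          (hs m (ℕ.m⊔n≤o⇒m≤o N M ≤m)) (ht n (ℕ.m⊔n≤o⇒n≤o N M ≤n))
      where
      step : ∀ a b c d → ∣ a ∣ ≤ K → ∣ d ∣ ≤ L →
        ∣ a * b - c * d ∣ ≤ (K + L) * (∣ a - c ∣ + ∣ b - d ∣)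
      step a b c d a≤K d≤L = begin
        ∣ a * b - c * d ∣
          ≡⟨ cong ∣_∣ (solve 4 (λ a b c d → a :* b :- c :* d := a :* (b :- d) :+ d :* (a :- c))
               refl a b c d) ⟩
        ∣ a * (b - d) + d * (a - c) ∣
          ≤⟨ ℚ.∣p+q∣≤∣p∣+∣q∣ (a * (b - d)) (d * (a - c)) ⟩
        ∣ a * (b - d) ∣ + ∣ d * (a - c) ∣
          ≡⟨ cong₂ _+_ (ℚ.∣p*q∣≡∣p∣*∣q∣ a (b - d)) (ℚ.∣p*q∣≡∣p∣*∣q∣ d (a - c)) ⟩
        ∣ a ∣ * Y + ∣ d ∣ * X
          ≤⟨ ℚ.+-mono-≤ (*-monoʳ 0≤Y a≤K) (*-monoʳ 0≤X d≤L) ⟩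
        K * Y + L * X
          ≤⟨ p≤p+nonNeg (+-nonNeg (*-nonNeg (ℚ.<⇒≤ 0<K) 0≤X) (*-nonNeg (ℚ.<⇒≤ 0<L) 0≤Y)) ⟩
        (K * Y + L * X) + (K * X + L * Y)
          ≡⟨ solve 4 (λ k l u v → (k :* v :+ l :* u) :+ (k :* u :+ l :* v)
               := (k :+ l) :* (u :+ v)) refl K L X Y ⟩
        (K + L) * (X + Y) ∎
        where
        X Y : ℚ
        X = ∣ a - c ∣
        Y = ∣ b - d ∣
        0≤X : 0ℚ ≤ X
        0≤X = ℚ.0≤∣p∣ (a - c)
        0≤Y : 0ℚ ≤ Y
        0≤Y = ℚ.0≤∣p∣ (b - d)

    *ℝ-cauchy : ∀ x y → Cauchy (λ n → seq x n * seq y n)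
    *ℝ-cauchy x y = aux (bounded x) (bounded y)
      where
      aux : ∃[ K ] (0ℚ < K × ∃[ N ] (∀ n → N ℕ.≤ n → ∣ seq x n ∣ ≤ K)) →
            ∃[ L ] (0ℚ < L × ∃[ M ] (∀ n → M ℕ.≤ n → ∣ seq y n ∣ ≤ L)) →
            Cauchy (λ n → seq x n * seq y n)
      aux (K , 0<K , N , hx) (L , 0<L , M , hy) =
        *-cauchy (seq x) (seq y) 0<K 0<L N M hx hy (cauchy x) (cauchy y)

_*ℝ_ : ℝ → ℝ → ℝ
x *ℝ y = mkℝ (λ n → seq x n * seq y n) (*ℝ-cauchy x y)

_-ℝ_ : ℝ → ℝ → ℝ
x -ℝ y = x +ℝ (fromℚ (- 1ℚ) *ℝ y)

∑ : ∀ {X : Set} → List X → (X → ℝ) → ℝ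
∑ xs f = foldr (λ x acc → f x +ℝ acc) 0ℝ xs

syntax ∑ xs (λ x → e) = ∑[ x ∈ xs ] e
infix 5 ∑

private
  -- On [ε, ∞) reciprocals have Lipschitz constant (recip ε)².
  recip-lip : ∀ {ε p q} → 0ℚ < ε → ε ≤ p → ε ≤ q →
              ∣ recip p - recip q ∣ ≤ recip ε * recip ε * (∣ p - q ∣ + ∣ p - q ∣)
  recip-lip {ε} {p} {q} 0<ε ε≤p ε≤q = begin
    ∣ P - Q ∣
      ≡⟨ cong ∣_∣ (cong₂ _-_ (ℚ.*-identityʳ P) (ℚ.*-identityʳ Q)) ⟨
    ∣ P * 1ℚ - Q * 1ℚ ∣
      ≡⟨ cong ∣_∣ (cong₂ (λ a b → P * a - Q * b) (recip-* 0<q) (recip-* 0<p)) ⟨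
    ∣ P * (Q * q) - Q * (P * p) ∣
      ≡⟨ cong ∣_∣ (solve 4 (λ P Q p q → P :* (Q :* q) :- Q :* (P :* p)
           := (P :* Q) :* (q :- p)) refl P Q p q) ⟩
    ∣ (P * Q) * (q - p) ∣
      ≡⟨ ℚ.∣p*q∣≡∣p∣*∣q∣ (P * Q) (q - p) ⟩
    ∣ P * Q ∣ * ∣ q - p ∣
      ≡⟨ cong₂ _*_ (ℚ.0≤p⇒∣p∣≡p (*-nonNeg 0≤P 0≤Q)) (∣∣-comm q p) ⟩
    P * Q * ∣ p - q ∣
      ≤⟨ *-mono (ℚ.0≤∣p∣ (p - q)) (*-nonNeg 0≤E 0≤E)
           (*-mono 0≤Q 0≤E (recip-anti 0<ε ε≤p) (recip-anti 0<ε ε≤q))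
           (p≤p+nonNeg (ℚ.0≤∣p∣ (p - q))) ⟩
    E * E * (∣ p - q ∣ + ∣ p - q ∣) ∎
    where
    P Q E : ℚ
    P = recip p
    Q = recip q
    E = recip ε
    0<p : 0ℚ < p
    0<p = ℚ.<-≤-trans 0<ε ε≤p
    0<q : 0ℚ < q
    0<q = ℚ.<-≤-trans 0<ε ε≤q
    0≤P : 0ℚ ≤ P
    0≤P = ℚ.<⇒≤ (recip-pos 0<p)
    0≤Q : 0ℚ ≤ Q
    0≤Q = ℚ.<⇒≤ (recip-pos 0<q)
    0≤E : 0ℚ ≤ E
    0≤E = ℚ.<⇒≤ (recip-pos 0<ε)

  0+ : ∀ {p q} → 0ℚ + p ≤ q → p ≤ q
  0+ {p} {q} = subst (_≤ q) (ℚ.+-identityˡ p)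

  abstract
    1/-cauchy : ∀ x → 0ℝ <ℝ x → Cauchy (λ n → recip (seq x n))
    1/-cauchy x (ε , 0<ε , N , h) =
      lipschitz (seq x) (seq x) (λ n → recip (seq x n))
        (recip ε * recip ε) (*-pos (recip-pos 0<ε) (recip-pos 0<ε)) N
        (λ m n ≤m ≤n → recip-lip 0<ε (0+ (h m ≤m)) (0+ (h n ≤n)))
        (cauchy x) (cauchy x)

1/ℝ : (x : ℝ) → 0ℝ <ℝ x → ℝ
1/ℝ x 0<x = mkℝ (λ n → recip (seq x n)) (1/-cauchy x 0<x)

abstract
  1/ℝ-pos : ∀ x (0<x : 0ℝ <ℝ x) → 0ℝ <ℝ 1/ℝ x 0<x
  1/ℝ-pos x (ε , 0<ε , N , h) = go (bounded x)
    where
    go : ∃[ K ] (0ℚ < K × ∃[ M ] (∀ n → M ℕ.≤ n → ∣ seq x n ∣ ≤ K)) →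
         0ℝ <ℝ 1/ℝ x (ε , 0<ε , N , h)
    go (K , 0<K , M , b) = recip K , recip-pos 0<K , N ℕ.⊔ M , λ n ≤n →
      subst (_≤ recip (seq x n)) (sym (ℚ.+-identityˡ (recip K)))
        (recip-anti
          (ℚ.<-≤-trans 0<ε (0+ (h n (ℕ.m⊔n≤o⇒m≤o N M ≤n))))
          (ℚ.≤-trans (p≤∣p∣ (seq x n)) (b n (ℕ.m⊔n≤o⇒n≤o N M ≤n))))

------------------------------------------------------------------------
-- The natural logarithm

-- artanhSum n z = Σ_{k<n} z^(2k+1) / (2k+1)
artanhSum : ℕ → ℚ → ℚ
artanhSum zero    z = 0ℚ
artanhSum (suc k) z = artanhSum k z + z ^ suc (k ℕ.* 2) * (+ 1 / suc (k ℕ.* 2))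

private
  unit : ℕ → ℚ
  unit k = + 1 / suc k

  unit-anti : ∀ {m n} → m ℕ.≤ n → unit n ≤ unit m
  unit-anti {m} {n} m≤n = ℚ.toℚᵘ-cancel-≤ (ℚᵘ.≤-trans
    (ℚᵘ.≤-reflexive (ℚ.toℚᵘ-fromℚᵘ (ℚᵘ.mkℚᵘ (+ 1) n)))
    (ℚᵘ.≤-trans (ℚᵘ.*≤* (ℤ.*-monoˡ-≤-nonNeg (+ 1) (ℤ.+≤+ (ℕ.s≤s m≤n))))
      (ℚᵘ.≤-reflexive (ℚᵘ.≃-sym (ℚ.toℚᵘ-fromℚᵘ (ℚᵘ.mkℚᵘ (+ 1) m))))))

  unit-pos : ∀ k → 0ℚ < unit k
  unit-pos k = ℚ.positive⁻¹ (unit k) {{ℚ.normalize-pos 1 (suc k)}}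

  0≤unit : ∀ k → 0ℚ ≤ unit k
  0≤unit k = ℚ.<⇒≤ (unit-pos k)

  archimedean : ∀ ε → 0ℚ < ε → ∃[ N ] (∀ n → N ℕ.≤ n → unit n ≤ ε)
  archimedean (mkℚ -[1+ _ ] _ _) (*<* ())
  archimedean (mkℚ +0       _ _) (*<* (ℤ.+<+ ()))
  archimedean (mkℚ +[1+ a ] d c) _ = d , λ n d≤n → ℚ.toℚᵘ-cancel-≤ (ℚᵘ.≤-trans
    (ℚᵘ.≤-reflexive (ℚ.toℚᵘ-fromℚᵘ (ℚᵘ.mkℚᵘ (+ 1) n)))
    (ℚᵘ.*≤* (ℤ.+≤+ (ℕ.*-mono-≤ {1} {suc a} (ℕ.s≤s ℕ.z≤n) (ℕ.s≤s d≤n)))))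

  nat : ℕ → ℚ
  nat m = + m / 1

  nat-suc : ∀ m → nat (suc m) ≡ 1ℚ + nat m
  nat-suc m = ℚ.toℚᵘ-injective (ℚᵘ.≃-trans (ℚ.toℚᵘ-fromℚᵘ (ℚᵘ.mkℚᵘ (+ suc m) 0))
    (ℚᵘ.≃-trans (ℚᵘ.≃-trans e
      (ℚᵘ.+-congʳ ℚᵘ.1ℚᵘ (ℚᵘ.≃-sym (ℚ.toℚᵘ-fromℚᵘ (ℚᵘ.mkℚᵘ (+ m) 0)))))
      (ℚᵘ.≃-sym (ℚ.toℚᵘ-homo-+ 1ℚ (nat m)))))
    where
    e : ℚᵘ.mkℚᵘ (+ suc m) 0 ℚᵘ.≃ ℚᵘ.1ℚᵘ ℚᵘ.+ ℚᵘ.mkℚᵘ (+ m) 0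
    e = ℚᵘ.*≡* (cong (λ k → k ℤ.* + 1)
      (cong (λ k → + 1 ℤ.+ k) (sym (ℤ.*-identityʳ (+ m)))))

  nat*unit : ∀ m → nat (suc m) * unit m ≡ 1ℚ
  nat*unit m = ℚ.toℚᵘ-injective (ℚᵘ.≃-trans (ℚ.toℚᵘ-homo-* (nat (suc m)) (unit m))
    (ℚᵘ.≃-trans
      (ℚᵘ.*-cong (ℚ.toℚᵘ-fromℚᵘ (ℚᵘ.mkℚᵘ (+ suc m) 0)) (ℚ.toℚᵘ-fromℚᵘ (ℚᵘ.mkℚᵘ (+ 1) m)))
      (ℚᵘ.*≡* e)))
    where
    e : (+ suc m ℤ.* + 1) ℤ.* + 1 ≡ + 1 ℤ.* + suc (m ℕ.+ 0)
    e = trans (ℤ.*-identityʳ (+ suc m ℤ.* + 1)) (trans (ℤ.*-identityʳ (+ suc m))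
      (trans (cong (λ k → + suc k) (sym (ℕ.+-identityʳ m)))
        (sym (ℤ.*-identityˡ (+ suc (m ℕ.+ 0))))))

  0≤nat : ∀ m → 0ℚ ≤ nat m
  0≤nat m = ℚ.nonNegative⁻¹ (nat m) {{ℚ.normalize-nonNeg m 1}}

  module Bounds (ρ : ℚ) (0≤ρ : 0ℚ ≤ ρ) (ρ<1 : ρ < 1ℚ) where

    ρ≤1 : ρ ≤ 1ℚ
    ρ≤1 = ℚ.<⇒≤ ρ<1

    0<1-ρ : 0ℚ < 1ℚ - ρ
    0<1-ρ = subst (_< 1ℚ - ρ) (ℚ.+-inverseʳ ρ) (ℚ.+-monoˡ-< (- ρ) ρ<1)

    C : ℚ
    C = recip (1ℚ - ρ)

    0<C : 0ℚ < C
    0<C = recip-pos 0<1-ρ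

    ^-nonNeg : ∀ m → 0ℚ ≤ ρ ^ m
    ^-nonNeg zero    = 0≤1
    ^-nonNeg (suc m) = *-nonNeg 0≤ρ (^-nonNeg m)

    ^-suc-≤ : ∀ m → ρ ^ suc m ≤ ρ ^ m
    ^-suc-≤ m = begin
      ρ * ρ ^ m  ≤⟨ *-monoʳ (^-nonNeg m) ρ≤1 ⟩
      1ℚ * ρ ^ m ≡⟨ ℚ.*-identityˡ (ρ ^ m) ⟩
      ρ ^ m      ∎

    geom : ℕ → ℚ
    geom zero    = 0ℚ
    geom (suc k) = geom k + ρ ^ (k ℕ.* 2)

    0≤geom : ∀ n → 0ℚ ≤ geom n
    0≤geom zero    = ℚ.≤-refl
    0≤geom (suc n) = +-nonNeg (0≤geom n) (^-nonNeg (n ℕ.* 2))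

    geom-step : ∀ g p → (1ℚ - ρ) * g ≤ 1ℚ - p → ρ * (ρ * p) ≤ ρ * p →
                (1ℚ - ρ) * (g + p) ≤ 1ℚ - ρ * (ρ * p)
    geom-step g p h₁ h₂ = begin
      (1ℚ - ρ) * (g + p)
        ≡⟨ solve 3 (λ r g p → (con 1ℚ :- r) :* (g :+ p)
             := (con 1ℚ :- r) :* g :+ (p :- r :* p)) refl ρ g p ⟩
      (1ℚ - ρ) * g + (p - ρ * p)
        ≤⟨ ℚ.+-mono-≤ h₁ (ℚ.+-monoʳ-≤ p (ℚ.neg-antimono-≤ h₂)) ⟩
      (1ℚ - p) + (p - ρ * (ρ * p))
        ≡⟨ solve 2 (λ r p → (con 1ℚ :- p) :+ (p :- r :* (r :* p))
             := con 1ℚ :- r :* (r :* p)) refl ρ p ⟩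
      1ℚ - ρ * (ρ * p) ∎

    geom-bound : ∀ n → (1ℚ - ρ) * geom n ≤ 1ℚ - ρ ^ (n ℕ.* 2)
    geom-bound zero    = ℚ.≤-reflexive (trans (ℚ.*-zeroʳ (1ℚ - ρ)) (sym (ℚ.+-inverseʳ 1ℚ)))
    geom-bound (suc n) = geom-step (geom n) (ρ ^ (n ℕ.* 2)) (geom-bound n)
                           (^-suc-≤ (suc (n ℕ.* 2)))

    1-nonNeg≤1 : ∀ {p} → 0ℚ ≤ p → 1ℚ - p ≤ 1ℚ
    1-nonNeg≤1 {p} 0≤p = subst (1ℚ - p ≤_) (ℚ.+-identityʳ 1ℚ)
      (ℚ.+-monoʳ-≤ 1ℚ (ℚ.neg-antimono-≤ 0≤p))

    geom≤C : ∀ n → geom n ≤ C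
    geom≤C n = begin
      geom n                   ≡⟨ ℚ.*-identityˡ (geom n) ⟨
      1ℚ * geom n              ≡⟨ cong (_* geom n) (recip-* 0<1-ρ) ⟨
      (C * (1ℚ - ρ)) * geom n  ≡⟨ ℚ.*-assoc C (1ℚ - ρ) (geom n) ⟩
      C * ((1ℚ - ρ) * geom n)  ≤⟨ *-monoˡ (ℚ.<⇒≤ 0<C) (ℚ.≤-trans (geom-bound n)
                                    (1-nonNeg≤1 (^-nonNeg (n ℕ.* 2)))) ⟩
      C * 1ℚ                   ≡⟨ ℚ.*-identityʳ C ⟩
      C                        ∎

    ^-abs : ∀ {z} → ∣ z ∣ ≤ ρ → ∀ m → ∣ z ^ m ∣ ≤ ρ ^ m
    ^-abs     z≤ρ zero    = ℚ.≤-refl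
    ^-abs {z} z≤ρ (suc m) = begin
      ∣ z * z ^ m ∣     ≡⟨ ℚ.∣p*q∣≡∣p∣*∣q∣ z (z ^ m) ⟩
      ∣ z ∣ * ∣ z ^ m ∣ ≤⟨ *-mono (ℚ.0≤∣p∣ (z ^ m)) 0≤ρ z≤ρ (^-abs z≤ρ m) ⟩
      ρ * ρ ^ m         ∎

    ^-lip : ∀ {z w} → ∣ z ∣ ≤ ρ → ∣ w ∣ ≤ ρ → ∀ m →
            ∣ z ^ suc m - w ^ suc m ∣ ≤ nat (suc m) * ρ ^ m * ∣ z - w ∣
    ^-lip {z} {w} z≤ρ w≤ρ zero = ℚ.≤-reflexive (trans
      (cong₂ (λ a b → ∣ a - b ∣) (ℚ.*-identityʳ z) (ℚ.*-identityʳ w))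
      (sym (ℚ.*-identityˡ ∣ z - w ∣)))
    ^-lip {z} {w} z≤ρ w≤ρ (suc m) =
      step (z ^ suc m) (w ^ suc m) (ρ ^ m) (nat (suc m)) (nat (suc (suc m)))
        (nat-suc (suc m)) (^-lip z≤ρ w≤ρ m) (^-abs w≤ρ (suc m))
      where
      D : ℚ
      D = ∣ z - w ∣
      step : ∀ a b r k k' → k' ≡ 1ℚ + k → ∣ a - b ∣ ≤ k * r * D → ∣ b ∣ ≤ ρ * r →
             ∣ z * a - w * b ∣ ≤ k' * (ρ * r) * D
      step a b r k k' eq h₁ h₂ = begin
        ∣ z * a - w * b ∣
          ≡⟨ cong ∣_∣ (solve 4 (λ z a w b → z :* a :- w :* b
               := z :* (a :- b) :+ b :* (z :- w)) refl z a w b) ⟩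
        ∣ z * (a - b) + b * (z - w) ∣
          ≤⟨ ℚ.∣p+q∣≤∣p∣+∣q∣ (z * (a - b)) (b * (z - w)) ⟩
        ∣ z * (a - b) ∣ + ∣ b * (z - w) ∣
          ≡⟨ cong₂ _+_ (ℚ.∣p*q∣≡∣p∣*∣q∣ z (a - b)) (ℚ.∣p*q∣≡∣p∣*∣q∣ b (z - w)) ⟩
        ∣ z ∣ * ∣ a - b ∣ + ∣ b ∣ * D
          ≤⟨ ℚ.+-mono-≤ (*-mono (ℚ.0≤∣p∣ (a - b)) 0≤ρ z≤ρ h₁)
               (*-monoʳ (ℚ.0≤∣p∣ (z - w)) h₂) ⟩
        ρ * (k * r * D) + ρ * r * D
          ≡⟨ solve 4 (λ ρ k r D → ρ :* (k :* r :* D) :+ ρ :* r :* D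
               := (con 1ℚ :+ k) :* (ρ :* r) :* D) refl ρ k r D ⟩
        (1ℚ + k) * (ρ * r) * D
          ≡⟨ cong (λ j → j * (ρ * r) * D) eq ⟨
        k' * (ρ * r) * D ∎

    sum-lip : ∀ {z w} → ∣ z ∣ ≤ ρ → ∣ w ∣ ≤ ρ → ∀ n →
              ∣ artanhSum n z - artanhSum n w ∣ ≤ geom n * ∣ z - w ∣
    sum-lip {z} {w} z≤ρ w≤ρ zero = ℚ.≤-reflexive (sym (ℚ.*-zeroˡ ∣ z - w ∣))
    sum-lip {z} {w} z≤ρ w≤ρ (suc n) =
      step (artanhSum n z) (artanhSum n w) (z ^ suc (n ℕ.* 2)) (w ^ suc (n ℕ.* 2))
        (geom n) (ρ ^ (n ℕ.* 2)) (nat (suc (n ℕ.* 2))) (unit (n ℕ.* 2))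
        (0≤unit (n ℕ.* 2)) (nat*unit (n ℕ.* 2))
        (sum-lip z≤ρ w≤ρ n) (^-lip z≤ρ w≤ρ (n ℕ.* 2))
      where
      D : ℚ
      D = ∣ z - w ∣
      step : ∀ A B a b g r k u → 0ℚ ≤ u → k * u ≡ 1ℚ →
             ∣ A - B ∣ ≤ g * D → ∣ a - b ∣ ≤ k * r * D →
             ∣ (A + a * u) - (B + b * u) ∣ ≤ (g + r) * D
      step A B a b g r k u 0≤u ku≡1 h₁ h₂ = begin
        ∣ (A + a * u) - (B + b * u) ∣
          ≡⟨ cong ∣_∣ (solve 5 (λ A B a b u → (A :+ a :* u) :- (B :+ b :* u)
               := (A :- B) :+ (a :- b) :* u) refl A B a b u) ⟩
        ∣ (A - B) + (a - b) * u ∣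
          ≤⟨ ℚ.∣p+q∣≤∣p∣+∣q∣ (A - B) ((a - b) * u) ⟩
        ∣ A - B ∣ + ∣ (a - b) * u ∣
          ≡⟨ cong (λ t → ∣ A - B ∣ + t) (trans (ℚ.∣p*q∣≡∣p∣*∣q∣ (a - b) u)
               (cong (λ t → ∣ a - b ∣ * t) (ℚ.0≤p⇒∣p∣≡p 0≤u))) ⟩
        ∣ A - B ∣ + ∣ a - b ∣ * u
          ≤⟨ ℚ.+-mono-≤ h₁ (*-monoʳ 0≤u h₂) ⟩
        g * D + k * r * D * u
          ≡⟨ solve 5 (λ g D k r u → g :* D :+ k :* r :* D :* u
               := g :* D :+ (k :* u) :* (r :* D)) refl g D k r u ⟩
        g * D + (k * u) * (r * D)
          ≡⟨ cong (λ j → g * D + j * (r * D)) ku≡1 ⟩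
        g * D + 1ℚ * (r * D)
          ≡⟨ solve 3 (λ g D r → g :* D :+ con 1ℚ :* (r :* D) := (g :+ r) :* D)
               refl g D r ⟩
        (g + r) * D ∎

    sum-tail : ∀ {z p n} → ∣ z ∣ ≤ ρ → p ℕ.≤ n → ∀ j →
               ∣ artanhSum (j ℕ.+ n) z - artanhSum n z ∣ ≤
               unit p * (geom (j ℕ.+ n) - geom n)
    sum-tail {z} {p} {n} z≤ρ p≤n zero = ℚ.≤-reflexive (trans
      (cong ∣_∣ (ℚ.+-inverseʳ (artanhSum n z)))
      (sym (trans (cong (unit p *_) (ℚ.+-inverseʳ (geom n))) (ℚ.*-zeroʳ (unit p)))))
    sum-tail {z} {p} {n} z≤ρ p≤n (suc j) =
      step (artanhSum k z) (artanhSum n z) (z ^ suc (k ℕ.* 2))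
        (geom k) (geom n) (ρ ^ (k ℕ.* 2)) (unit (k ℕ.* 2)) (unit p)
        (0≤unit (k ℕ.* 2)) (unit-anti p≤2k) (^-nonNeg (k ℕ.* 2))
        (sum-tail z≤ρ p≤n j)
        (ℚ.≤-trans (^-abs z≤ρ (suc (k ℕ.* 2))) (^-suc-≤ (k ℕ.* 2)))
      where
      k : ℕ
      k = j ℕ.+ n
      p≤2k : p ℕ.≤ k ℕ.* 2
      p≤2k = ℕ.≤-trans p≤n (ℕ.≤-trans (ℕ.m≤n+m n j) (ℕ.m≤m*n k 2))
      step : ∀ A B a g h r u v → 0ℚ ≤ u → u ≤ v → 0ℚ ≤ r →
             ∣ A - B ∣ ≤ v * (g - h) → ∣ a ∣ ≤ r →
             ∣ (A + a * u) - B ∣ ≤ v * ((g + r) - h)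
      step A B a g h r u v 0≤u u≤v 0≤r h₁ h₂ = begin
        ∣ (A + a * u) - B ∣
          ≡⟨ cong ∣_∣ (solve 3 (λ A c B → (A :+ c) :- B := (A :- B) :+ c)
               refl A (a * u) B) ⟩
        ∣ (A - B) + a * u ∣
          ≤⟨ ℚ.∣p+q∣≤∣p∣+∣q∣ (A - B) (a * u) ⟩
        ∣ A - B ∣ + ∣ a * u ∣
          ≡⟨ cong (λ t → ∣ A - B ∣ + t) (trans (ℚ.∣p*q∣≡∣p∣*∣q∣ a u)
               (cong (λ t → ∣ a ∣ * t) (ℚ.0≤p⇒∣p∣≡p 0≤u))) ⟩
        ∣ A - B ∣ + ∣ a ∣ * u
          ≤⟨ ℚ.+-mono-≤ h₁ (*-mono 0≤u 0≤r h₂ u≤v) ⟩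
        v * (g - h) + r * v
          ≡⟨ solve 4 (λ v g h r → v :* (g :- h) :+ r :* v := v :* ((g :+ r) :- h))
               refl v g h r ⟩
        v * ((g + r) - h) ∎

    sum-tail-≤ : ∀ {z p m n} → ∣ z ∣ ≤ ρ → p ℕ.≤ n → n ℕ.≤ m →
                 ∣ artanhSum m z - artanhSum n z ∣ ≤ C * unit p
    sum-tail-≤ {z} {p} {m} {n} z≤ρ p≤n n≤m = begin
      ∣ artanhSum m z - artanhSum n z ∣
        ≡⟨ cong (λ k → ∣ artanhSum k z - artanhSum n z ∣) (ℕ.m∸n+n≡m n≤m) ⟨
      ∣ artanhSum (j ℕ.+ n) z - artanhSum n z ∣
        ≤⟨ sum-tail z≤ρ p≤n j ⟩
      unit p * (geom (j ℕ.+ n) - geom n)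
        ≤⟨ *-monoˡ (0≤unit p) (ℚ.≤-trans (drop (0≤geom n)) (geom≤C (j ℕ.+ n))) ⟩
      unit p * C
        ≡⟨ ℚ.*-comm (unit p) C ⟩
      C * unit p ∎
      where
      j : ℕ
      j = m ℕ.∸ n
      drop : ∀ {a b} → 0ℚ ≤ b → a - b ≤ a
      drop {a} {b} 0≤b = subst (a - b ≤_) (ℚ.+-identityʳ a)
        (ℚ.+-monoʳ-≤ a (ℚ.neg-antimono-≤ 0≤b))

    sum-tails : ∀ {z p} m n → ∣ z ∣ ≤ ρ → p ℕ.≤ m → p ℕ.≤ n →
                ∣ artanhSum m z - artanhSum n z ∣ ≤ C * unit p
    sum-tails {z} {p} m n z≤ρ p≤m p≤n with ℕ.≤-total n m
    ... | inj₁ n≤m = sum-tail-≤ z≤ρ p≤n n≤m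
    ... | inj₂ m≤n = subst (_≤ C * unit p) (∣∣-comm (artanhSum n z) (artanhSum m z))
                       (sum-tail-≤ z≤ρ p≤m m≤n)

    artanh-cauchy : ∀ (s : ℕ → ℚ) N → (∀ n → N ℕ.≤ n → ∣ s n ∣ ≤ ρ) →
                    Cauchy s → Cauchy (λ n → artanhSum n (s n))
    artanh-cauchy s N hs cs ε 0<ε = go (halve C 0<ε 0<C)
      where
      go : ∃[ δ ] (0ℚ < δ × C * (δ + δ) ≡ ε) →
           ∃[ M ] (∀ m n → M ℕ.≤ m → M ℕ.≤ n →
             ∣ artanhSum m (s m) - artanhSum n (s n) ∣ ≤ ε)
      go (δ , 0<δ , eq) = N ℕ.⊔ (N₁ ℕ.⊔ N₂) , bound
        where
        N₁ N₂ : ℕ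
        N₁ = proj₁ (archimedean δ 0<δ)
        N₂ = proj₁ (cs δ 0<δ)
        left : ∀ {k} → N ℕ.⊔ (N₁ ℕ.⊔ N₂) ℕ.≤ k → N₁ ℕ.≤ k
        left h = ℕ.m⊔n≤o⇒m≤o N₁ N₂ (ℕ.m⊔n≤o⇒n≤o N (N₁ ℕ.⊔ N₂) h)
        right : ∀ {k} → N ℕ.⊔ (N₁ ℕ.⊔ N₂) ℕ.≤ k → N₂ ℕ.≤ k
        right h = ℕ.m⊔n≤o⇒n≤o N₁ N₂ (ℕ.m⊔n≤o⇒n≤o N (N₁ ℕ.⊔ N₂) h)
        triangle : ∀ a b c → ∣ a - c ∣ ≤ ∣ a - b ∣ + ∣ b - c ∣
        triangle a b c = ℚ.≤-trans
          (ℚ.≤-reflexive (cong ∣_∣ (solve 3 (λ a b c → a :- c := (a :- b) :+ (b :- c))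
            refl a b c)))
          (ℚ.∣p+q∣≤∣p∣+∣q∣ (a - b) (b - c))
        bound : ∀ m n → N ℕ.⊔ (N₁ ℕ.⊔ N₂) ℕ.≤ m → N ℕ.⊔ (N₁ ℕ.⊔ N₂) ℕ.≤ n →
                ∣ artanhSum m (s m) - artanhSum n (s n) ∣ ≤ ε
        bound m n ≤m ≤n = begin
          ∣ artanhSum m (s m) - artanhSum n (s n) ∣
            ≤⟨ triangle (artanhSum m (s m)) (artanhSum n (s m)) (artanhSum n (s n)) ⟩
          ∣ artanhSum m (s m) - artanhSum n (s m) ∣ + ∣ artanhSum n (s m) - artanhSum n (s n) ∣
            ≤⟨ ℚ.+-mono-≤ (sum-tails m n sm≤ρ (left ≤m) (left ≤n)) (sum-lip sm≤ρ sn≤ρ n) ⟩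
          C * unit N₁ + geom n * ∣ s m - s n ∣
            ≤⟨ ℚ.+-mono-≤
                 (*-monoˡ (ℚ.<⇒≤ 0<C) (proj₂ (archimedean δ 0<δ) N₁ ℕ.≤-refl))
                 (*-mono (ℚ.0≤∣p∣ (s m - s n)) (ℚ.<⇒≤ 0<C) (geom≤C n)
                   (proj₂ (cs δ 0<δ) m n (right ≤m) (right ≤n))) ⟩
          C * δ + C * δ
            ≡⟨ ℚ.*-distribˡ-+ C δ δ ⟨
          C * (δ + δ)
            ≡⟨ eq ⟩
          ε ∎
          where
          sm≤ρ : ∣ s m ∣ ≤ ρ
          sm≤ρ = hs m (ℕ.m⊔n≤o⇒m≤o N (N₁ ℕ.⊔ N₂) ≤m)
          sn≤ρ : ∣ s n ∣ ≤ ρ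
          sn≤ρ = hs n (ℕ.m⊔n≤o⇒m≤o N (N₁ ℕ.⊔ N₂) ≤n)

  add-≤ : ∀ {a b c} → a + b ≤ c → a ≤ c - b
  add-≤ {a} {b} {c} h = begin
    a         ≡⟨ solve 2 (λ a b → a := (a :+ b) :- b) refl a b ⟩
    a + b - b ≤⟨ ℚ.+-monoˡ-≤ (- b) h ⟩
    c - b     ∎

  ⊓-pos : ∀ {p q} → 0ℚ < p → 0ℚ < q → 0ℚ < p ⊓ q
  ⊓-pos {p} {q} 0<p 0<q with ℚ.⊓-sel p q
  ... | inj₁ e = subst (0ℚ <_) (sym e) 0<p
  ... | inj₂ e = subst (0ℚ <_) (sym e) 0<q

  abstract
    -- The radius 1 - min δ₁ δ₂ bounds a sequence lying in [-1 + δ₁, 1 - δ₂].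
    artanh-cauchy′ : ∀ z → fromℚ (- 1ℚ) <ℝ z → z <ℝ 1ℝ → Cauchy (λ n → artanhSum n (seq z n))
    artanh-cauchy′ z (δ₁ , 0<δ₁ , N₁ , h₁) (δ₂ , 0<δ₂ , N₂ , h₂) =
      Bounds.artanh-cauchy ρ 0≤ρ ρ<1 (seq z) (N₁ ℕ.⊔ N₂)
        (λ n ≤n → bound n (ℕ.m⊔n≤o⇒m≤o N₁ N₂ ≤n) (ℕ.m⊔n≤o⇒n≤o N₁ N₂ ≤n)) (cauchy z)
      where
      δ ρ : ℚ
      δ = δ₁ ⊓ δ₂
      ρ = 1ℚ - δ
      bound : ∀ n → N₁ ℕ.≤ n → N₂ ℕ.≤ n → ∣ seq z n ∣ ≤ ρ
      bound n ≤n₁ ≤n₂ = ∣∣-bound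
        (ℚ.≤-trans (add-≤ (h₂ n ≤n₂)) (ℚ.+-monoʳ-≤ 1ℚ (ℚ.neg-antimono-≤ (ℚ.p⊓q≤q δ₁ δ₂))))
        (ℚ.≤-trans
          (subst (- seq z n ≤_)
            (solve 1 (λ d → :- (con (- 1ℚ) :+ d) := con 1ℚ :- d) refl δ₁)
            (ℚ.neg-antimono-≤ (h₁ n ≤n₁)))
          (ℚ.+-monoʳ-≤ 1ℚ (ℚ.neg-antimono-≤ (ℚ.p⊓q≤p δ₁ δ₂))))
      0≤ρ : 0ℚ ≤ ρ
      0≤ρ = ℚ.≤-trans (ℚ.0≤∣p∣ (seq z (N₁ ℕ.⊔ N₂)))
        (bound (N₁ ℕ.⊔ N₂) (ℕ.m≤m⊔n N₁ N₂) (ℕ.m≤n⊔m N₁ N₂))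
      ρ<1 : ρ < 1ℚ
      ρ<1 = subst (ρ <_) (ℚ.+-identityʳ 1ℚ)
        (ℚ.+-monoʳ-< 1ℚ (ℚ.neg-antimono-< (⊓-pos 0<δ₁ 0<δ₂)))

artanh : (z : ℝ) → fromℚ (- 1ℚ) <ℝ z → z <ℝ 1ℝ → ℝ
artanh z -1<z z<1 = mkℝ (λ n → artanhSum n (seq z n)) (artanh-cauchy′ z -1<z z<1)

private
  abstract
    1+-pos : ∀ x → 0ℝ <ℝ x → 0ℝ <ℝ x +ℝ 1ℝ
    1+-pos x (ε , 0<ε , N , h) = ε , 0<ε , N , λ n N≤n →
      ℚ.≤-trans (h n N≤n) (p≤p+nonNeg 0≤1)

-- (x - 1) / (x + 1)
möbius : (x : ℝ) → 0ℝ <ℝ x → ℝ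
möbius x 0<x = (x -ℝ 1ℝ) *ℝ 1/ℝ (x +ℝ 1ℝ) (1+-pos x 0<x)

private
  -- With r = 1 / (q + 1):  (q - 1) r = -1 + 2 q r = 1 - 2 r.
  möbius-lower : ∀ q r → r * (q + 1ℚ) ≡ 1ℚ →
                 (q + - 1ℚ * 1ℚ) * r ≡ - 1ℚ + (q * r + q * r)
  möbius-lower q r e = trans
    (solve 2 (λ q r → (q :+ con (- 1ℚ) :* con 1ℚ) :* r
       := (q :* r :+ q :* r) :- r :* (q :+ con 1ℚ)) refl q r)
    (trans (cong (λ t → (q * r + q * r) - t) e) (ℚ.+-comm (q * r + q * r) (- 1ℚ)))

  möbius-upper : ∀ q r → r * (q + 1ℚ) ≡ 1ℚ →
                 (q + - 1ℚ * 1ℚ) * r + (r + r) ≡ 1ℚ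
  möbius-upper q r e = trans
    (solve 2 (λ q r → (q :+ con (- 1ℚ) :* con 1ℚ) :* r :+ (r :+ r)
       := r :* (q :+ con 1ℚ)) refl q r) e

abstract
  möbius>-1 : ∀ x 0<x → fromℚ (- 1ℚ) <ℝ möbius x 0<x
  möbius>-1 x 0<x@(ε , 0<ε , N , h) = go (bounded (x +ℝ 1ℝ))
    where
    go : ∃[ K ] (0ℚ < K × ∃[ M ] (∀ n → M ℕ.≤ n → ∣ seq x n + 1ℚ ∣ ≤ K)) →
         fromℚ (- 1ℚ) <ℝ möbius x 0<x
    go (K , 0<K , M , b) = ε * recip K , *-pos 0<ε (recip-pos 0<K) , N ℕ.⊔ M , λ n ≤n →
      bound (seq x n) (0+ (h n (ℕ.m⊔n≤o⇒m≤o N M ≤n))) (b n (ℕ.m⊔n≤o⇒n≤o N M ≤n))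
      where
      bound : ∀ q → ε ≤ q → ∣ q + 1ℚ ∣ ≤ K →
              - 1ℚ + ε * recip K ≤ (q + - 1ℚ * 1ℚ) * recip (q + 1ℚ)
      bound q ε≤q q≤K = begin
        - 1ℚ + ε * recip K
          ≤⟨ ℚ.+-monoʳ-≤ (- 1ℚ) (ℚ.≤-trans
               (*-mono (ℚ.<⇒≤ (recip-pos 0<K)) 0≤q ε≤q
                 (recip-anti 0<q+1 (ℚ.≤-trans (p≤∣p∣ (q + 1ℚ)) q≤K)))
               (p≤p+nonNeg (*-nonNeg 0≤q (ℚ.<⇒≤ (recip-pos 0<q+1))))) ⟩
        - 1ℚ + (q * recip (q + 1ℚ) + q * recip (q + 1ℚ))
          ≡⟨ möbius-lower q (recip (q + 1ℚ)) (recip-* 0<q+1) ⟨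
        (q + - 1ℚ * 1ℚ) * recip (q + 1ℚ) ∎
        where
        0<q : 0ℚ < q
        0<q = ℚ.<-≤-trans 0<ε ε≤q
        0≤q : 0ℚ ≤ q
        0≤q = ℚ.<⇒≤ 0<q
        0<q+1 : 0ℚ < q + 1ℚ
        0<q+1 = +-pos-nonNeg 0<q 0≤1

  möbius<1 : ∀ x 0<x → möbius x 0<x <ℝ 1ℝ
  möbius<1 x 0<x@(ε , 0<ε , N , h) = go (bounded (x +ℝ 1ℝ))
    where
    go : ∃[ K ] (0ℚ < K × ∃[ M ] (∀ n → M ℕ.≤ n → ∣ seq x n + 1ℚ ∣ ≤ K)) →
         möbius x 0<x <ℝ 1ℝ
    go (K , 0<K , M , b) = recip K , recip-pos 0<K , N ℕ.⊔ M , λ n ≤n →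
      bound (seq x n) (0+ (h n (ℕ.m⊔n≤o⇒m≤o N M ≤n))) (b n (ℕ.m⊔n≤o⇒n≤o N M ≤n))
      where
      bound : ∀ q → ε ≤ q → ∣ q + 1ℚ ∣ ≤ K →
              (q + - 1ℚ * 1ℚ) * recip (q + 1ℚ) + recip K ≤ 1ℚ
      bound q ε≤q q≤K = begin
        (q + - 1ℚ * 1ℚ) * recip (q + 1ℚ) + recip K
          ≤⟨ ℚ.+-monoʳ-≤ ((q + - 1ℚ * 1ℚ) * recip (q + 1ℚ)) (ℚ.≤-trans
               (recip-anti 0<q+1 (ℚ.≤-trans (p≤∣p∣ (q + 1ℚ)) q≤K))
               (p≤p+nonNeg (ℚ.<⇒≤ (recip-pos 0<q+1)))) ⟩
        (q + - 1ℚ * 1ℚ) * recip (q + 1ℚ) + (recip (q + 1ℚ) + recip (q + 1ℚ))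
          ≡⟨ möbius-upper q (recip (q + 1ℚ)) (recip-* 0<q+1) ⟩
        1ℚ ∎
        where
        0<q+1 : 0ℚ < q + 1ℚ
        0<q+1 = +-pos-nonNeg (ℚ.<-≤-trans 0<ε ε≤q) 0≤1

-- ln x = 2 artanh ((x - 1) / (x + 1)), a series converging for every x > 0
-- since artanh z = ½ ln ((1 + z) / (1 - z)).
ln : (x : ℝ) → 0ℝ <ℝ x → ℝ
ln x 0<x = fromℕ 2 *ℝ artanh (möbius x 0<x) (möbius>-1 x 0<x) (möbius<1 x 0<x)

------------------------------------------------------------------------
-- The hypercube

Vertex : ℕ → Set
Vertex d = Vec Bool d

vertices : ∀ d → List (Vertex d)
vertices zero    = [] ∷ []
vertices (suc d) = map (false ∷_) (vertices d) ++ map (true ∷_) (vertices d)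

hamming : ∀ {d} → Vertex d → Vertex d → ℕ
hamming []       []       = 0
hamming (x ∷ xs) (y ∷ ys) = (if x xor y then 1 else 0) ℕ.+ hamming xs ys

IsMidpoint : ∀ {d} → Vertex d → Vertex d → Pred (Vertex d) 0ℓ
IsMidpoint a b u =
  (hamming a u ≡ ⌊ hamming a b /2⌋ × hamming a u ℕ.+ hamming u b ≡ hamming a b) ⊎
  (hamming a u ≡ ⌈ hamming a b /2⌉ × hamming a u ℕ.+ hamming u b ≡ hamming a b)

isMidpoint? : ∀ {d} (a b : Vertex d) → Decidable (IsMidpoint a b)
isMidpoint? a b u =
  ((hamming a u ℕ.≟ ⌊ hamming a b /2⌋) ×-dec (hamming a u ℕ.+ hamming u b ℕ.≟ hamming a b))
  ⊎-dec
  ((hamming a u ℕ.≟ ⌈ hamming a b /2⌉) ×-dec (hamming a u ℕ.+ hamming u b ℕ.≟ hamming a b))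

-- The set m̂(a,b), listed without repetition.
midpoints : ∀ {d} → Vertex d → Vertex d → List (Vertex d)
midpoints {d} a b = filter (isMidpoint? a b) (vertices d)

record VertexSet (d : ℕ) : Set where
  field
    elements : List (Vertex d)
    unique   : Unique elements
    nonempty : elements ≢ []
open VertexSet public

------------------------------------------------------------------------
-- Measures, transportations and entropy

Measure : ℕ → Set
Measure d = Vertex d → ℝ

module _ {d : ℕ} where
  open DecMembership (≡-dec {n = d} Bool._≟_) public using (_∈?_)

∈⇒NonZero : ∀ {X : Set} {x : X} {xs} → x ∈ xs → ℕ.NonZero (length xs)
∈⇒NonZero (here _)  = _
∈⇒NonZero (there _) = _

-- Mass m shared equally among the vertices listed in S.
spread : ∀ {d} → ℝ → List (Vertex d) → Measure d
spread m S v with v ∈? S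
... | yes v∈S = m *ℝ fromℚ ((+ 1 / length S) {{∈⇒NonZero v∈S}})
... | no  _   = 0ℝ

uniform : ∀ {d} → VertexSet d → Measure d
uniform A = spread 1ℝ (elements A)

-- A plan is a function on A × B: its values elsewhere are never used.
Plan : ℕ → Set
Plan d = Vertex d → Vertex d → ℝ

record IsTransportation {d} (A B : VertexSet d) (τ : Plan d) : Set where
  field
    0≤τ         : ∀ {α β} → α ∈ elements A → β ∈ elements B → 0ℝ ≤ℝ τ α β
    sourceMass  : ∀ {α} → α ∈ elements A →
                  uniform A α ≃ℝ ∑[ β ∈ elements B ] τ α β
    targetMass  : ∀ {β} → β ∈ elements B →
                  uniform B β ≃ℝ ∑[ α ∈ elements A ] τ α β

cost : ∀ {d} → VertexSet d → VertexSet d → Plan d → ℝ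
cost A B τ = ∑[ α ∈ elements A ] ∑[ β ∈ elements B ]
  (τ α β *ℝ fromℕ (hamming α β ℕ.* hamming α β))

record IsOptimal {d} (A B : VertexSet d) (τ : Plan d) : Set where
  field
    isTransportation : IsTransportation A B τ
    minimal : ∀ σ → IsTransportation A B σ → cost A B τ ≤ℝ cost A B σ

midpointMeasure : ∀ {d} → VertexSet d → VertexSet d → Plan d → Measure d
midpointMeasure A B τ γ = ∑[ α ∈ elements A ] ∑[ β ∈ elements B ]
  spread (τ α β) (midpoints α β) γ

-- Whether a nonnegative real vanishes is undecidable, so the terms of the
-- entropy that are 0 by the convention 0 ln (1/0) = 0 must be identified.
ZeroOrPositive : ∀ {d} → Measure d → Set
ZeroOrPositive μ = ∀ v → μ v ≃ℝ 0ℝ ⊎ 0ℝ <ℝ μ v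

entropyTerm : (y : ℝ) → y ≃ℝ 0ℝ ⊎ 0ℝ <ℝ y → ℝ
entropyTerm y (inj₁ _)   = 0ℝ
entropyTerm y (inj₂ 0<y) = y *ℝ ln (1/ℝ y 0<y) (1/ℝ-pos y 0<y)

entropy : ∀ {d} (μ : Measure d) → ZeroOrPositive μ → ℝ
entropy {d} μ z = ∑[ v ∈ vertices d ] entropyTerm (μ v) (z v)

uniform-zeroOrPositive : ∀ {d} (A : VertexSet d) → ZeroOrPositive (uniform A)
uniform-zeroOrPositive A v with v ∈? elements A
... | no  _   = inj₁ ((λ ε 0<ε → 0 , λ _ _ → p≤p+nonNeg (ℚ.<⇒≤ 0<ε)) ,
                     (λ ε 0<ε → 0 , λ _ _ → p≤p+nonNeg (ℚ.<⇒≤ 0<ε)))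
... | yes v∈A = inj₂ (u , 0<u , 0 , λ _ _ → ℚ.≤-reflexive
    (trans (ℚ.+-identityˡ u) (sym (ℚ.*-identityˡ u))))
  where
  instance
    _ : ℕ.NonZero (length (elements A))
    _ = ∈⇒NonZero v∈A
  u : ℚ
  u = + 1 / length (elements A)
  0<u : 0ℚ < u
  0<u = ℚ.positive⁻¹ u {{ℚ.normalize-pos 1 (length (elements A))}}

{-# OPTIONS --safe #-}

-- Already in dimension 6 (further coordinates are set to 0), group the coordinates
-- into three pairs.  Let C be the 8 vertices all of whose pairs are 00 or 11, A the 12
-- vertices with one pair 01 and the others 00 or 11, and B the image of A under swapping
-- the entries of each pair.  All vertices of A and B have odd weight and A, B are disjoint,
-- so distinct points are at distance at least 2; the plan α ↦ swap α moves every point by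
-- exactly 2, hence is optimal.  The midpoints of α and swap α are the two vertices obtained
-- by changing the pair 01 to 00 or 11, and each vertex of C arises from three α.  So the
-- midpoint measure is uniform on C, of entropy ln 8 < ln 12.

module Submission where

open import Defs
open import Data.Bool.Base using (Bool; true; false; if_then_else_; _xor_)
import Data.Bool.Properties as Bool
import Data.Integer.Base as ℤ
import Data.Integer.Properties as ℤ
open import Data.List.Base using (List; []; _∷_; _++_; map; filter; foldr; length)
open import Data.List.Membership.Propositional using (_∈_; _∉_)
open import Data.List.Membership.Propositional.Properties using (∈-map⁺; ∈-map⁻; ∈-++⁺ˡ; ∈-++⁺ʳ)
open import Data.List.Properties using (filter-++; filter-none; ++-identityʳ; length-map; map-id; map-∘)
import Data.List.Relation.Unary.All as All
open import Data.List.Relation.Unary.All using (All; []; _∷_)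
import Data.List.Relation.Unary.All.Properties as All
open import Data.List.Relation.Unary.AllPairs using ([]; _∷_)
open import Data.List.Relation.Unary.Any using (here; there)
open import Data.List.Relation.Unary.Unique.Propositional using (Unique)
import Data.List.Relation.Unary.Unique.DecPropositional as DecUnique
import Data.List.Relation.Unary.Unique.Propositional.Properties as Unique
open import Data.Nat.Base as ℕ using (ℕ; zero; suc; _≤_; z≤n)
import Data.Nat.Properties as ℕ
open import Data.Product.Base using (Σ-syntax; ∃-syntax; _×_; _,_; proj₁; proj₂)
open import Data.Rational.Base as ℚ using (ℚ; 0ℚ; 1ℚ; ½; _+_; _*_; -_; _/_)
  renaming (_≤_ to _≤ℚ_; _<_ to _<ℚ_)
import Data.Rational.Properties as ℚ
open import Data.Rational.Solver using (module +-*-Solver)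
import Data.Rational.Unnormalised.Base as ℚᵘ
import Data.Rational.Unnormalised.Properties as ℚᵘ
open import Data.Sum.Base using (_⊎_; inj₁; inj₂)
open import Data.Vec.Base as Vec using ([]; _∷_)
open import Data.Vec.Properties using (≡-dec; ∷-injectiveʳ)
open import Function.Base using (_∘_)
open import Relation.Binary.PropositionalEquality
  using (_≡_; _≢_; refl; sym; trans; cong; cong₂; subst; module ≡-Reasoning)
open import Relation.Nullary using (¬_; Dec; yes; no; does)
open import Relation.Nullary.Decidable using (dec-true; dec-false; from-yes)
open import Relation.Unary using (Decidable)

private
  variable
    X Y : Set
    d : ℕ

infix 4 _≟_
_≟_ : (u v : Vertex d) → Dec (u ≡ v)
_≟_ = ≡-dec Bool._≟_

-- Finite sums of rationals

sumℚ : List X → (X → ℚ) → ℚ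
sumℚ xs f = foldr (λ x s → f x + s) 0ℚ xs

seq-∑ : ∀ (xs : List X) (f : X → ℝ) n → seq (∑ xs f) n ≡ sumℚ xs (λ x → seq (f x) n)
seq-∑ []       f n = refl
seq-∑ (x ∷ xs) f n = cong (_+_ (seq (f x) n)) (seq-∑ xs f n)

sum-cong : ∀ {xs : List X} {f g : X → ℚ} → (∀ {x} → x ∈ xs → f x ≡ g x) → sumℚ xs f ≡ sumℚ xs g
sum-cong {xs = []}     f≗g = refl
sum-cong {xs = x ∷ xs} f≗g = cong₂ _+_ (f≗g (here refl)) (sum-cong (f≗g ∘ there))

sum-zero : ∀ {xs : List X} {f : X → ℚ} → (∀ {x} → x ∈ xs → f x ≡ 0ℚ) → sumℚ xs f ≡ 0ℚ
sum-zero {xs = []}     f≗0 = refl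
sum-zero {xs = x ∷ xs} f≗0 = cong₂ _+_ (f≗0 (here refl)) (sum-zero (f≗0 ∘ there))

sum-map : ∀ (h : X → Y) xs (f : Y → ℚ) → sumℚ (map h xs) f ≡ sumℚ xs (f ∘ h)
sum-map h []       f = refl
sum-map h (x ∷ xs) f = cong (_+_ (f (h x))) (sum-map h xs f)

sum-+ : ∀ (xs : List X) (f g : X → ℚ) → sumℚ xs (λ x → f x + g x) ≡ sumℚ xs f + sumℚ xs g
sum-+ []       f g = refl
sum-+ (x ∷ xs) f g = trans (cong (_+_ (f x + g x)) (sum-+ xs f g))
  (solve 4 (λ a b c e → a :+ b :+ (c :+ e) := (a :+ c) :+ (b :+ e)) refl (f x) (g x) (sumℚ xs f) (sumℚ xs g))
  where open +-*-Solver

sum-*ʳ : ∀ (xs : List X) (f : X → ℚ) c → sumℚ xs (λ x → f x * c) ≡ sumℚ xs f * c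
sum-*ʳ []       f c = sym (ℚ.*-zeroˡ c)
sum-*ʳ (x ∷ xs) f c = trans (cong (_+_ (f x * c)) (sum-*ʳ xs f c)) (sym (ℚ.*-distribʳ-+ c (f x) _))

sum-single : ∀ {xs : List X} {x} (f : X → ℚ) → Unique xs → x ∈ xs →
             (∀ {y} → y ≢ x → f y ≡ 0ℚ) → sumℚ xs f ≡ f x
sum-single {xs = y ∷ _} f (y∉ ∷ _) (here refl) f≗0 =
  trans (cong (f y +_) (sum-zero λ z∈ → f≗0 (All.lookup y∉ z∈ ∘ sym))) (ℚ.+-identityʳ (f y))
sum-single {xs = y ∷ _} f (y∉ ∷ u) (there x∈) f≗0 =
  trans (cong₂ _+_ (f≗0 (All.lookup y∉ x∈)) (sum-single f u x∈ f≗0)) (ℚ.+-identityˡ _)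

-- Measures taking a single nonzero value

-- The value c is a fixed rational, whereas in `spread` the value depends on the membership proof
-- through the `NonZero` instance. This lets values be rewritten and evaluated.
_on_ : ℚ → List (Vertex d) → Vertex d → ℚ
(c on S) v = if does (v ∈? S) then c else 0ℚ

on-∈ : ∀ c {S : List (Vertex d)} {v} → v ∈ S → (c on S) v ≡ c
on-∈ c {S} {v} v∈S = cong (if_then c else 0ℚ) (dec-true (v ∈? S) v∈S)

on-∉ : ∀ c {S : List (Vertex d)} {v} → v ∉ S → (c on S) v ≡ 0ℚ
on-∉ c {S} {v} v∉S = cong (if_then c else 0ℚ) (dec-false (v ∈? S) v∉S)

-- Brings sums over padded vertices back to dimension 6, where they can be evaluated.
on-preimage : ∀ {e} c {f : Vertex d → Vertex e} → (∀ {x y} → f x ≡ f y → x ≡ y) →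
              ∀ S v → (c on map f S) (f v) ≡ (c on S) v
on-preimage c {f} inj S v with v ∈? S
... | yes v∈S = on-∈ c (∈-map⁺ f v∈S)
... | no  v∉S = on-∉ c λ fv∈ → let (w , w∈S , fv≡fw) = ∈-map⁻ f fv∈ in
  v∉S (subst (_∈ S) (sym (inj fv≡fw)) w∈S)

on-nonNeg : ∀ {c} → 0ℚ ≤ℚ c → ∀ (S : List (Vertex d)) v → 0ℚ ≤ℚ (c on S) v
on-nonNeg 0≤c S v with does (v ∈? S)
... | true  = 0≤c
... | false = ℚ.≤-refl

seq-spread : ∀ {l} m {S : List (Vertex d)} v n → length S ≡ suc l →
             seq (spread m S v) n ≡ ((seq m n * (ℤ.+ 1 / suc l)) on S) v
seq-spread {l = l} m {S@(_ ∷ _)} v n refl with v ∈? S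
... | yes v∈S = sym (on-∈ (seq m n * (ℤ.+ 1 / suc l)) v∈S)
... | no  v∉S = sym (on-∉ (seq m n * (ℤ.+ 1 / suc l)) v∉S)

-- Handles the pairs that carry no mass, so that their midpoints never have to be counted.
seq-spread-zero : ∀ m (S : List (Vertex d)) v n → seq m n ≡ 0ℚ → seq (spread m S v) n ≡ 0ℚ
seq-spread-zero m S v n m≡0 with v ∈? S
... | yes v∈S = trans (cong (_* q) m≡0) (ℚ.*-zeroˡ q)
  where
  q : ℚ
  q = (ℤ.+ 1 / length S) {{∈⇒NonZero v∈S}}
... | no  _ = refl

-- Induction on S, splitting off the point mass at its first vertex x. Uniqueness of V makes this
-- point mass sum to c, and uniqueness of S prevents x from being counted again in the rest.
sum-on : ∀ c {V S : List (Vertex d)} → Unique V → Unique S → (∀ {v} → v ∈ S → v ∈ V) →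
         sumℚ V (c on S) ≡ sumℚ S (λ _ → c)
sum-on c {V} {[]} uV _ _ = sum-zero {xs = V} λ _ → refl
sum-on c {V} {x ∷ S} uV (x∉S ∷ uS) S⊆V = begin
  sumℚ V (c on (x ∷ S))                        ≡⟨ sum-cong {xs = V} (λ {v} _ → split v) ⟩
  sumℚ V (λ v → δ v + (c on S) v)              ≡⟨ sum-+ V δ (c on S) ⟩
  sumℚ V δ + sumℚ V (c on S)                   ≡⟨ cong₂ _+_ sum-δ (sum-on c uV uS (S⊆V ∘ there)) ⟩
  c + sumℚ S (λ _ → c)                         ∎
  where
  open ≡-Reasoning
  δ : Vertex _ → ℚ
  δ v = if does (v ≟ x) then c else 0ℚ
  sum-δ : sumℚ V δ ≡ c
  sum-δ = trans
    (sum-single δ uV (S⊆V (here refl)) λ {y} y≢x → cong (if_then c else 0ℚ) (dec-false (y ≟ x) y≢x))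
    (cong (if_then c else 0ℚ) (dec-true (x ≟ x) refl))
  split : ∀ v → (c on (x ∷ S)) v ≡ δ v + (c on S) v
  split v with v ≟ x
  ... | yes refl = sym (trans (cong (_+_ c) (on-∉ c λ x∈S → All.lookup x∉S x∈S refl)) (ℚ.+-identityʳ c))
  ... | no  _    = sym (ℚ.+-identityˡ _)

-- Entropy

∈-vertices : ∀ {d} (v : Vertex d) → v ∈ vertices d
∈-vertices []          = here refl
∈-vertices (false ∷ v) = ∈-++⁺ˡ (∈-map⁺ _ (∈-vertices v))
∈-vertices (true  ∷ v) = ∈-++⁺ʳ _ (∈-map⁺ _ (∈-vertices v))

vertices-unique : ∀ d → Unique (vertices d)
vertices-unique zero    = [] ∷ []
vertices-unique (suc d) = Unique.++⁺
  (Unique.map⁺ ∷-injectiveʳ (vertices-unique d)) (Unique.map⁺ ∷-injectiveʳ (vertices-unique d))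
  λ (f , t) → disjoint (∈-map⁻ _ f) (∈-map⁻ _ t)
  where
  disjoint : ∀ {v} → ∃[ u ] (u ∈ vertices d × v ≡ false ∷ u) →
          ∃[ u ] (u ∈ vertices d × v ≡ true ∷ u) → _
  disjoint (_ , _ , refl) (_ , _ , ())

-- (r - 1) / (r + 1) at r = 1/q, in the form produced by ln.
möbiusRecip : ℚ → ℚ
möbiusRecip q = (recip q + - 1ℚ * 1ℚ) * recip (recip q + 1ℚ)

-- The n-th approximation of ln (1/q).
lnRecip : ℕ → ℚ → ℚ
lnRecip n q = ℤ.+ 2 / 1 * artanhSum n (möbiusRecip q)

entropySummand : ℕ → ℚ → ℚ
entropySummand n q = q * lnRecip n q

-- This is the convention 0 ln (1/0) = 0: since `recip` is total, the second factor is some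
-- rational, and the factor 0 removes it.
entropySummand-zero : ∀ n → entropySummand n 0ℚ ≡ 0ℚ
entropySummand-zero n = ℚ.*-zeroˡ (lnRecip n 0ℚ)

-- Termwise comparison of logarithms

^-mono : ∀ {x y} → 0ℚ ≤ℚ x → x ≤ℚ y → ∀ n → 0ℚ ≤ℚ x ^ n × x ^ n ≤ℚ y ^ n
^-mono 0≤x x≤y zero = ℚ.nonNegative⁻¹ 1ℚ , ℚ.≤-refl
^-mono {x} {y} 0≤x x≤y (suc n) =
    ℚ.nonNegative⁻¹ (x * x ^ n) {{ℚ.nonNeg*nonNeg⇒nonNeg x (x ^ n)}}
  , ℚ.≤-trans (ℚ.*-monoʳ-≤-nonNeg (x ^ n) x≤y) (ℚ.*-monoˡ-≤-nonNeg y (proj₂ (^-mono 0≤x x≤y n)))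
  where
  instance
    x-nonNeg : ℚ.NonNegative x
    x-nonNeg = ℚ.nonNegative 0≤x
    y-nonNeg : ℚ.NonNegative y
    y-nonNeg = ℚ.nonNegative (ℚ.≤-trans 0≤x x≤y)
    x^n-nonNeg : ℚ.NonNegative (x ^ n)
    x^n-nonNeg = ℚ.nonNegative (proj₁ (^-mono 0≤x x≤y n))

-- The linear term of the series contributes exactly y - x, and the later terms are monotone on
-- nonnegative arguments. The index starts at `suc n` because the empty sum has no linear term.
artanhSum-gap : ∀ {x y} → 0ℚ ≤ℚ x → x ≤ℚ y → ∀ n →
                artanhSum (suc n) x + (y + - x) ≤ℚ artanhSum (suc n) y
artanhSum-gap {x} {y} 0≤x x≤y zero = ℚ.≤-reflexive
  (solve 2 (λ x y → con 0ℚ :+ x :* con 1ℚ :* con 1ℚ :+ (y :+ :- x)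
    := con 0ℚ :+ y :* con 1ℚ :* con 1ℚ) refl x y)
  where open +-*-Solver
artanhSum-gap {x} {y} 0≤x x≤y (suc n) = begin
  artanhSum (suc n) x + x ^ m * u + (y + - x)
    ≡⟨ solve 3 (λ a b c → a :+ b :+ c := a :+ c :+ b) refl (artanhSum (suc n) x) (x ^ m * u) (y + - x) ⟩
  artanhSum (suc n) x + (y + - x) + x ^ m * u
    ≤⟨ ℚ.+-mono-≤ (artanhSum-gap 0≤x x≤y n)
         (ℚ.*-monoʳ-≤-nonNeg u {{ℚ.normalize-nonNeg 1 m}} (proj₂ (^-mono 0≤x x≤y m))) ⟩
  artanhSum (suc n) y + y ^ m * u ∎
  where
  open ℚ.≤-Reasoning
  open +-*-Solver
  m : ℕ
  m = suc (suc n ℕ.* 2)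
  u : ℚ
  u = ℤ.+ 1 / m

-- The bound δ is independent of n, as the witness of a strict inequality of reals has to be.
lnRecip-gap : ∀ p q {δ} → 0ℚ ≤ℚ möbiusRecip p → möbiusRecip p ≤ℚ möbiusRecip q →
  δ ≡ ℤ.+ 2 / 1 * (möbiusRecip q + - möbiusRecip p) →
  ∀ n → lnRecip (suc n) p + δ ≤ℚ lnRecip (suc n) q
lnRecip-gap p q 0≤x x≤y refl n = subst (_≤ℚ lnRecip (suc n) q)
  (ℚ.*-distribˡ-+ (ℤ.+ 2 / 1) (artanhSum (suc n) (möbiusRecip p)) (möbiusRecip q + - möbiusRecip p))
  (ℚ.*-monoˡ-≤-nonNeg (ℤ.+ 2 / 1) (artanhSum-gap 0≤x x≤y n))

-- Entropy of a uniform distribution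

≤-by-approximation : ∀ {p q} → (∀ ε → 0ℚ <ℚ ε → p ≤ℚ q + ε) → p ≤ℚ q
-- If q < p, take r strictly between them and ε = r - q: then p ≤ r, against r < p.
≤-by-approximation {p} {q} h = ℚ.≮⇒≥ λ q<p → let (r , q<r , r<p) = ℚ.<-dense q<p in
  ℚ.<-irrefl refl (ℚ.<-≤-trans r<p (subst (p ≤ℚ_) (q+r-q≡r r)
    (h (r + - q) (subst (_<ℚ r + - q) (ℚ.+-inverseʳ q) (ℚ.+-monoˡ-< (- q) q<r)))))
  where
  open +-*-Solver
  q+r-q≡r : ∀ r → q + (r + - q) ≡ r
  q+r-q≡r r = solve 2 (λ q r → q :+ (r :+ :- q) := r) refl q r

seq-constant-≃0 : ∀ {y q} → (∀ n → seq y n ≡ q) → y ≃ℝ 0ℝ → q ≡ 0ℚ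
seq-constant-≃0 y≡q (y≤0 , 0≤y) = ℚ.≤-antisym
  (≤-by-approximation λ ε 0<ε → let (N , h) = y≤0 ε 0<ε in
    subst (_≤ℚ 0ℚ + ε) (y≡q N) (h N ℕ.≤-refl))
  (≤-by-approximation λ ε 0<ε → let (N , h) = 0≤y ε 0<ε in
    subst (λ p → 0ℚ ≤ℚ p + ε) (y≡q N) (h N ℕ.≤-refl))

-- The evidence z is arbitrary, so both alternatives must give the same value. If z declares y to be
-- zero, then q = 0 by `seq-constant-≃0`, and the summand vanishes too.
seq-entropyTerm : ∀ {y q} → (∀ n → seq y n ≡ q) → ∀ z n →
                  seq (entropyTerm y z) n ≡ entropySummand n q
seq-entropyTerm {y} y≡q (inj₁ y≃0) n =
  trans (sym (entropySummand-zero n)) (cong (entropySummand n) (sym (seq-constant-≃0 {y} y≡q y≃0)))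
seq-entropyTerm y≡q (inj₂ _)   n = cong (entropySummand n) (y≡q n)

-- Vertices outside S contribute 0, and on S the logarithm is a common factor of terms whose masses
-- add up to 1. The equality holds at every index, not only in the limit.
seq-entropy : ∀ {μ : Measure d} {c S} → Unique S → sumℚ S (λ _ → c) ≡ 1ℚ →
              (∀ v n → seq (μ v) n ≡ (c on S) v) →
              ∀ z n → seq (entropy μ z) n ≡ lnRecip n c
seq-entropy {d} {μ} {c} {S} uS total≡1 μ≡c z n = begin
  seq (entropy μ z) n                                   ≡⟨ seq-∑ (vertices d) (λ v → entropyTerm (μ v) (z v)) n ⟩
  sumℚ (vertices d) (λ v → seq (entropyTerm (μ v) (z v)) n)
    ≡⟨ sum-cong {xs = vertices d} (λ {v} _ → trans (seq-entropyTerm {μ v} (μ≡c v) (z v) n) (distrib v)) ⟩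
  sumℚ (vertices d) (entropySummand n c on S)
    ≡⟨ sum-on (entropySummand n c) (vertices-unique d) uS (λ {v} _ → ∈-vertices v) ⟩
  sumℚ S (λ _ → c * lnRecip n c)                        ≡⟨ sum-*ʳ S (λ _ → c) (lnRecip n c) ⟩
  sumℚ S (λ _ → c) * lnRecip n c                        ≡⟨ cong (_* lnRecip n c) total≡1 ⟩
  1ℚ * lnRecip n c                                      ≡⟨ ℚ.*-identityˡ (lnRecip n c) ⟩
  lnRecip n c                                           ∎
  where
  open ≡-Reasoning
  distrib : ∀ v → entropySummand n ((c on S) v) ≡ (entropySummand n c on S) v
  distrib v with does (v ∈? S)
  ... | true  = refl
  ... | false = entropySummand-zero n

-- The order on the reals

p≤p+ε : ∀ {p ε} → 0ℚ <ℚ ε → p ≤ℚ p + ε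
p≤p+ε {p} {ε} 0<ε = subst (_≤ℚ p + ε) (ℚ.+-identityʳ p) (ℚ.+-monoʳ-≤ p (ℚ.<⇒≤ 0<ε))

pointwise⇒≤ℝ : ∀ {x y} → (∀ n → seq x n ≤ℚ seq y n) → x ≤ℝ y
pointwise⇒≤ℝ x≤y ε 0<ε = 0 , λ n _ → ℚ.≤-trans (x≤y n) (p≤p+ε 0<ε)

pointwise⇒≃ℝ : ∀ {x y} → (∀ n → seq x n ≡ seq y n) → x ≃ℝ y
pointwise⇒≃ℝ {x} {y} x≡y =
  pointwise⇒≤ℝ {x} {y} (ℚ.≤-reflexive ∘ x≡y) , pointwise⇒≤ℝ {y} {x} (ℚ.≤-reflexive ∘ sym ∘ x≡y)

-- The sign is decidable here because the sequence is a constant rational.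
constant-zeroOrPositive : ∀ {y q} → (∀ n → seq y n ≡ q) → 0ℚ ≤ℚ q → y ≃ℝ 0ℝ ⊎ 0ℝ <ℝ y
constant-zeroOrPositive {y} {q} y≡q 0≤q with 0ℚ ℚ.<? q
... | yes 0<q = inj₂ (q , 0<q , 0 , λ n _ → ℚ.≤-reflexive (trans (ℚ.+-identityˡ q) (sym (y≡q n))))
... | no  0≮q = inj₁ (pointwise⇒≃ℝ {y} {0ℝ} λ n → trans (y≡q n) (ℚ.≤-antisym (ℚ.≮⇒≥ 0≮q) 0≤q))

-- 1 + c instead of c in the denominator allows c = 0.
shrink : ∀ {c ε} → 0ℚ ≤ℚ c → 0ℚ <ℚ ε → ∃[ δ ] (0ℚ <ℚ δ × δ * c ≤ℚ ε)
shrink {c} {ε} 0≤c 0<ε = ε * r , 0<δ , (begin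
  ε * r * c            ≤⟨ ℚ.*-monoˡ-≤-nonNeg (ε * r) {{ℚ.nonNegative (ℚ.<⇒≤ 0<δ)}} c≤1+c ⟩
  ε * r * (1ℚ + c)     ≡⟨ ℚ.*-assoc ε r (1ℚ + c) ⟩
  ε * (r * (1ℚ + c))   ≡⟨ cong (ε *_) (ℚ.*-inverseˡ (1ℚ + c)) ⟩
  ε * 1ℚ               ≡⟨ ℚ.*-identityʳ ε ⟩
  ε                    ∎)
  where
  open ℚ.≤-Reasoning
  instance
    1+c-positive : ℚ.Positive (1ℚ + c)
    1+c-positive = ℚ.positive (ℚ.+-mono-<-≤ (ℚ.positive⁻¹ 1ℚ) 0≤c)
    1+c-nonZero : ℚ.NonZero (1ℚ + c)
    1+c-nonZero = ℚ.pos⇒nonZero (1ℚ + c)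
  r : ℚ
  r = ℚ.1/ (1ℚ + c)
  0<δ : 0ℚ <ℚ ε * r
  0<δ = ℚ.positive⁻¹ (ε * r) {{ℚ.pos*pos⇒pos ε {{ℚ.positive 0<ε}} r {{ℚ.1/pos⇒pos (1ℚ + c)}}}}
  c≤1+c : c ≤ℚ 1ℚ + c
  c≤1+c = subst (_≤ℚ 1ℚ + c) (ℚ.+-identityˡ c) (ℚ.+-monoˡ-≤ c (ℚ.<⇒≤ (ℚ.positive⁻¹ 1ℚ)))

half : ∀ {ε} → 0ℚ <ℚ ε → 0ℚ <ℚ ε * ½
half {ε} 0<ε = ℚ.positive⁻¹ (ε * ½) {{ℚ.pos*pos⇒pos ε {{ℚ.positive 0<ε}} ½}}

≤ℝ-trans : ∀ {x y z} → x ≤ℝ y → y ≤ℝ z → x ≤ℝ z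
≤ℝ-trans {x} {y} {z} x≤y y≤z ε 0<ε =
  let (N , h) = x≤y (ε * ½) (half 0<ε)
      (M , k) = y≤z (ε * ½) (half 0<ε)
  in N ℕ.⊔ M , λ n ≤n → begin
    seq x n                       ≤⟨ h n (ℕ.m⊔n≤o⇒m≤o N M ≤n) ⟩
    seq y n + ε * ½               ≤⟨ ℚ.+-monoˡ-≤ (ε * ½) (k n (ℕ.m⊔n≤o⇒n≤o N M ≤n)) ⟩
    seq z n + ε * ½ + ε * ½       ≡⟨ solve 2 (λ z e → z :+ e :* con ½ :+ e :* con ½ := z :+ e) refl (seq z n) ε ⟩
    seq z n + ε                   ∎
  where
  open ℚ.≤-Reasoning
  open +-*-Solver

+ℝ-mono : ∀ {w x y z} → w ≤ℝ x → y ≤ℝ z → (w +ℝ y) ≤ℝ (x +ℝ z)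
+ℝ-mono {w} {x} {y} {z} w≤x y≤z ε 0<ε =
  let (N , h) = w≤x (ε * ½) (half 0<ε)
      (M , k) = y≤z (ε * ½) (half 0<ε)
  in N ℕ.⊔ M , λ n ≤n → begin
    seq w n + seq y n                         ≤⟨ ℚ.+-mono-≤ (h n (ℕ.m⊔n≤o⇒m≤o N M ≤n)) (k n (ℕ.m⊔n≤o⇒n≤o N M ≤n)) ⟩
    (seq x n + ε * ½) + (seq z n + ε * ½)     ≡⟨ solve 3 (λ x z e → (x :+ e :* con ½) :+ (z :+ e :* con ½) := x :+ z :+ e)
                                                   refl (seq x n) (seq z n) ε ⟩
    seq x n + seq z n + ε                     ∎
  where
  open ℚ.≤-Reasoning
  open +-*-Solver

∑-mono : ∀ {xs : List X} {f g : X → ℝ} → (∀ {x} → x ∈ xs → f x ≤ℝ g x) → ∑ xs f ≤ℝ ∑ xs g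
∑-mono {xs = []}             f≤g = pointwise⇒≤ℝ {0ℝ} {0ℝ} λ _ → ℚ.≤-refl
∑-mono {xs = x ∷ xs} {f} {g} f≤g =
  +ℝ-mono {f x} {g x} {∑ xs f} {∑ xs g} (f≤g (here refl)) (∑-mono (f≤g ∘ there))

seq-∑-*ℝ : ∀ (xs : List X) (f : X → ℝ) c n →
           seq (∑ xs (λ x → f x *ℝ fromℚ c)) n ≡ seq (∑ xs f *ℝ fromℚ c) n
seq-∑-*ℝ xs f c n = trans (seq-∑ xs (λ x → f x *ℝ fromℚ c) n)
  (trans (sum-*ʳ xs (λ x → seq (f x) n) c) (cong (_* c) (sym (seq-∑ xs f n))))

*ℝ-monoˡ : ∀ {x y c} → 0ℚ ≤ℚ c → x ≤ℝ y → (x *ℝ fromℚ c) ≤ℝ (y *ℝ fromℚ c)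
*ℝ-monoˡ {x} {y} {c} 0≤c x≤y ε 0<ε =
  let (δ , 0<δ , δc≤ε) = shrink 0≤c 0<ε
      (N , h) = x≤y δ 0<δ
  in N , λ n ≤n → begin
    seq x n * c           ≤⟨ ℚ.*-monoʳ-≤-nonNeg c {{ℚ.nonNegative 0≤c}} (h n ≤n) ⟩
    (seq y n + δ) * c     ≡⟨ ℚ.*-distribʳ-+ c (seq y n) δ ⟩
    seq y n * c + δ * c   ≤⟨ ℚ.+-monoʳ-≤ (seq y n * c) δc≤ε ⟩
    seq y n * c + ε       ∎
  where open ℚ.≤-Reasoning

-- A nonnegative real may have negative approximations, so the factor is first raised by δ.
-- Eventually `seq x n + δ` is nonnegative, and δ is small enough that δ * c costs at most ε.
*ℝ-monoʳ : ∀ {x b c} → 0ℝ ≤ℝ x → 0ℚ ≤ℚ b → b ≤ℚ c → (x *ℝ fromℚ b) ≤ℝ (x *ℝ fromℚ c)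
*ℝ-monoʳ {x} {b} {c} 0≤x 0≤b b≤c ε 0<ε =
  let (δ , 0<δ , δc≤ε) = shrink (ℚ.≤-trans 0≤b b≤c) 0<ε
      (N , h) = 0≤x δ 0<δ
  in N , λ n ≤n → begin
    seq x n * b           ≤⟨ ℚ.*-monoʳ-≤-nonNeg b {{ℚ.nonNegative 0≤b}} (p≤p+ε {seq x n} 0<δ) ⟩
    (seq x n + δ) * b     ≤⟨ ℚ.*-monoˡ-≤-nonNeg (seq x n + δ) {{ℚ.nonNegative (h n ≤n)}} b≤c ⟩
    (seq x n + δ) * c     ≡⟨ ℚ.*-distribʳ-+ c (seq x n) δ ⟩
    seq x n * c + δ * c   ≤⟨ ℚ.+-monoʳ-≤ (seq x n * c) δc≤ε ⟩
    seq x n * c + ε       ∎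
  where open ℚ.≤-Reasoning

-- Meant for sets A and B of equal size: their entropies have the same approximations g, and so does
-- the mean.
<ℝ-mean : ∀ x y z {f g : ℕ → ℚ} δ → 0ℚ <ℚ δ →
          (∀ n → seq x n ≡ f n) → (∀ n → seq y n ≡ g n) → (∀ n → seq z n ≡ g n) →
          (∀ n → f (suc n) + δ ≤ℚ g (suc n)) → x <ℝ fromℚ ½ *ℝ (y +ℝ z)
-- The threshold is 1 because the gap is assumed at successor indices only: at index 0 the logarithm
-- series is an empty sum.
<ℝ-mean x y z {f} {g} δ 0<δ x≡f y≡g z≡g f+δ≤g = δ , 0<δ , 1 , λ where
    zero    ()
    (suc n) _ → begin
      seq x (suc n) + δ                       ≡⟨ cong (_+ δ) (x≡f (suc n)) ⟩
      f (suc n) + δ                           ≤⟨ f+δ≤g n ⟩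
      g (suc n)                               ≡⟨ solve 1 (λ q → q := con ½ :* (q :+ q)) refl (g (suc n)) ⟩
      ½ * (g (suc n) + g (suc n))             ≡⟨ cong₂ (λ q r → ½ * (q + r)) (y≡g (suc n)) (z≡g (suc n)) ⟨
      ½ * (seq y (suc n) + seq z (suc n))     ∎
  where
  open ℚ.≤-Reasoning
  open +-*-Solver

-- Optimality

-- For variable numerators the reduction to lowest terms does not compute, so the comparison is made
-- on unnormalised fractions.
/1-mono : ∀ {m n} → m ≤ n → ℤ.+ m / 1 ≤ℚ ℤ.+ n / 1
/1-mono {m} {n} m≤n = ℚ.toℚᵘ-cancel-≤ (begin
  ℚ.toℚᵘ (ℤ.+ m / 1)   ≃⟨ ℚ.toℚᵘ-fromℚᵘ (ℚᵘ.mkℚᵘ (ℤ.+ m) 0) ⟩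
  ℚᵘ.mkℚᵘ (ℤ.+ m) 0    ≤⟨ ℚᵘ.*≤* (ℤ.*-monoʳ-≤-nonNeg (ℤ.+ 1) (ℤ.+≤+ m≤n)) ⟩
  ℚᵘ.mkℚᵘ (ℤ.+ n) 0    ≃⟨ ℚ.toℚᵘ-fromℚᵘ (ℚᵘ.mkℚᵘ (ℤ.+ n) 0) ⟨
  ℚ.toℚᵘ (ℤ.+ n / 1)   ∎)
  where open ℚᵘ.≤-Reasoning

0≤/1 : ∀ n → 0ℚ ≤ℚ ℤ.+ n / 1
0≤/1 n = /1-mono {0} {n} z≤n

module _ {A B : VertexSet d} {τ : Plan d} where

  -- Row by row, every plan pays at least m per unit of mass, while τ pays exactly m. The condition
  -- on τ is an equation of products, so it covers both pairs of squared distance m and pairs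
  -- without mass.
  constant-distance-optimal : ∀ m → IsTransportation A B τ →
    (∀ {α β} → α ∈ elements A → β ∈ elements B → m ≤ hamming α β ℕ.* hamming α β) →
    (∀ {α β} → α ∈ elements A → β ∈ elements B → ∀ n →
       seq (τ α β *ℝ fromℕ (hamming α β ℕ.* hamming α β)) n ≡ seq (τ α β *ℝ fromℕ m) n) →
    IsOptimal A B τ
  constant-distance-optimal m transport m≤ supp = record
    { isTransportation = transport
    ; minimal = λ σ tσ → ∑-mono {xs = elements A}
        {λ α → ∑ Bs (λ β → τ α β *ℝ weight α β)} {λ α → ∑ Bs (λ β → σ α β *ℝ weight α β)}
        λ {α} → row σ tσ {α}
    }
    where
    Bs : List (Vertex d)
    Bs = elements B
    weight : Vertex d → Vertex d → ℝ
    weight α β = fromℕ (hamming α β ℕ.* hamming α β)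
    row : ∀ σ → IsTransportation A B σ → ∀ {α} → α ∈ elements A →
          ∑ Bs (λ β → τ α β *ℝ weight α β) ≤ℝ ∑ Bs (λ β → σ α β *ℝ weight α β)
    row σ tσ {α} α∈A =
      ≤ℝ-trans {∑ Bs (λ β → τ α β *ℝ weight α β)} {∑ Bs (τ α) *ℝ fromℕ m} {∑ Bs (λ β → σ α β *ℝ weight α β)}
        (pointwise⇒≤ℝ {∑ Bs (λ β → τ α β *ℝ weight α β)} {∑ Bs (τ α) *ℝ fromℕ m} λ n → ℚ.≤-reflexive (begin
          seq (∑ Bs (λ β → τ α β *ℝ weight α β)) n    ≡⟨ seq-∑ Bs _ n ⟩
          sumℚ Bs (λ β → seq (τ α β *ℝ weight α β) n) ≡⟨ sum-cong {xs = Bs} (λ β∈B → supp α∈A β∈B n) ⟩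
          sumℚ Bs (λ β → seq (τ α β *ℝ fromℕ m) n)    ≡⟨ seq-∑ Bs _ n ⟨
          seq (∑ Bs (λ β → τ α β *ℝ fromℕ m)) n       ≡⟨ seq-∑-*ℝ Bs (τ α) (ℤ.+ m / 1) n ⟩
          seq (∑ Bs (τ α) *ℝ fromℕ m) n               ∎))
      (≤ℝ-trans {∑ Bs (τ α) *ℝ fromℕ m} {∑ Bs (σ α) *ℝ fromℕ m} {∑ Bs (λ β → σ α β *ℝ weight α β)}
        -- The two plans are linked here: both row sums equal the mass of α.
        (*ℝ-monoˡ {∑ Bs (τ α)} {∑ Bs (σ α)} (0≤/1 m)
          (≤ℝ-trans {∑ Bs (τ α)} {uniform A α} {∑ Bs (σ α)}
            (proj₂ (IsTransportation.sourceMass transport α∈A))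
            (proj₁ (IsTransportation.sourceMass tσ α∈A))))
      (≤ℝ-trans {∑ Bs (σ α) *ℝ fromℕ m} {∑ Bs (λ β → σ α β *ℝ fromℕ m)} {∑ Bs (λ β → σ α β *ℝ weight α β)}
        (proj₂ (pointwise⇒≃ℝ {∑ Bs (λ β → σ α β *ℝ fromℕ m)} {∑ Bs (σ α) *ℝ fromℕ m}
          (seq-∑-*ℝ Bs (σ α) (ℤ.+ m / 1))))
        (∑-mono {xs = Bs} {λ β → σ α β *ℝ fromℕ m} {λ β → σ α β *ℝ weight α β}
          λ {β} β∈B → *ℝ-monoʳ {σ α β} (IsTransportation.0≤τ tσ α∈A β∈B) (0≤/1 m) (/1-mono (m≤ α∈A β∈B)))))
      where open ≡-Reasoning

-- Adding zero coordinates

-- Adds up the inequality over the coordinates. It serves to keep midpoints inside the padded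
-- subcube.
hamming-triangle : ∀ (a u b : Vertex d) → hamming a b ≤ hamming a u ℕ.+ hamming u b
hamming-triangle []      []      []      = z≤n
hamming-triangle (x ∷ a) (y ∷ u) (z ∷ b) = ℕ.≤-trans
  (ℕ.+-mono-≤ (bit-triangle x y z) (hamming-triangle a u b))
  (ℕ.≤-reflexive (interchange (bit x y) (bit y z) (hamming a u) (hamming u b)))
  where
  open import Algebra.Properties.CommutativeSemigroup ℕ.+-commutativeSemigroup using (interchange)
  bit : Bool → Bool → ℕ
  bit x y = if x xor y then 1 else 0
  bit-triangle : ∀ x y z → bit x z ≤ bit x y ℕ.+ bit y z
  bit-triangle false false z     = ℕ.≤-refl
  bit-triangle true  true  z     = ℕ.≤-refl
  bit-triangle false true  false = z≤n
  bit-triangle false true  true  = ℕ.≤-refl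
  bit-triangle true  false true  = z≤n
  bit-triangle true  false false = ℕ.≤-refl

-- A vertex beginning with `true` lengthens both legs by 1, so by the triangle inequality it lies on
-- no shortest path.
midpoints-false∷ : ∀ (a b : Vertex d) → midpoints (false ∷ a) (false ∷ b) ≡ map (false ∷_) (midpoints a b)
midpoints-false∷ {d} a b = begin
  filter mid? (map (false ∷_) (vertices d) ++ map (true ∷_) (vertices d))
    ≡⟨ filter-++ mid? (map (false ∷_) (vertices d)) _ ⟩
  filter mid? (map (false ∷_) (vertices d)) ++ filter mid? (map (true ∷_) (vertices d))
    ≡⟨ cong₂ _++_ (filter-false (vertices d)) (filter-none mid? (All.map⁺ (All.universal not-true (vertices d)))) ⟩
  map (false ∷_) (midpoints a b) ++ []
    ≡⟨ ++-identityʳ _ ⟩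
  map (false ∷_) (midpoints a b) ∎
  where
  open ≡-Reasoning
  mid? : Decidable (IsMidpoint (false ∷ a) (false ∷ b))
  mid? = isMidpoint? (false ∷ a) (false ∷ b)
  filter-false : ∀ us → filter mid? (map (false ∷_) us) ≡ map (false ∷_) (filter (isMidpoint? a b) us)
  filter-false []       = refl
  -- The coordinate `false` adds 0 to all distances, so both filters make the same decision by
  -- computation.
  filter-false (u ∷ us) with does (isMidpoint? a b u)
  ... | true  = cong ((false ∷ u) ∷_) (filter-false us)
  ... | false = filter-false us
  longer : ∀ u → suc (hamming a u) ℕ.+ suc (hamming u b) ≢ hamming a b
  longer u eq = ℕ.<⇒≱ (ℕ.≤-<-trans (hamming-triangle a u b)
    (ℕ.+-mono-< (ℕ.n<1+n (hamming a u)) (ℕ.n<1+n (hamming u b)))) (ℕ.≤-reflexive eq)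
  not-true : ∀ u → ¬ IsMidpoint (false ∷ a) (false ∷ b) (true ∷ u)
  not-true u (inj₁ (_ , eq)) = longer u eq
  not-true u (inj₂ (_ , eq)) = longer u eq

-- The zeros stand in front, so that induction on k prepends one `false` at a time and
-- `midpoints-false∷` applies.
pad : ∀ k → Vertex d → Vertex (k ℕ.+ d)
pad k v = Vec.replicate k false Vec.++ v

drop-pad : ∀ k (v : Vertex d) → Vec.drop k (pad k v) ≡ v
drop-pad zero    v = refl
drop-pad (suc k) v = drop-pad k v

pad-injective : ∀ k {u v : Vertex d} → pad k u ≡ pad k v → u ≡ v
pad-injective k {u} {v} eq = trans (sym (drop-pad k u)) (trans (cong (Vec.drop k) eq) (drop-pad k v))

hamming-pad : ∀ k (a b : Vertex d) → hamming (pad k a) (pad k b) ≡ hamming a b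
hamming-pad zero    a b = refl
hamming-pad (suc k) a b = hamming-pad k a b

midpoints-pad : ∀ k (a b : Vertex d) → midpoints (pad k a) (pad k b) ≡ map (pad k) (midpoints a b)
midpoints-pad zero    a b = sym (map-id (midpoints a b))
midpoints-pad (suc k) a b = begin
  midpoints (false ∷ pad k a) (false ∷ pad k b)         ≡⟨ midpoints-false∷ (pad k a) (pad k b) ⟩
  map (false ∷_) (midpoints (pad k a) (pad k b))        ≡⟨ cong (map (false ∷_)) (midpoints-pad k a b) ⟩
  map (false ∷_) (map (pad k) (midpoints a b))          ≡⟨ map-∘ (midpoints a b) ⟨
  map (pad (suc k)) (midpoints a b)                     ∎
  where open ≡-Reasoning

-- The example in dimension 6

diagonal : ∀ m → List (Vertex (m ℕ.* 2))
diagonal zero    = [] ∷ []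
diagonal (suc m) = map (λ v → false ∷ false ∷ v) (diagonal m) ++ map (λ v → true ∷ true ∷ v) (diagonal m)

-- There are m * 2^(m-1) such vertices, against 2^m in `diagonal m`; m = 3 is the first case with
-- more of them, 12 against 8.
nearDiagonal : ∀ m → List (Vertex (m ℕ.* 2))
nearDiagonal zero    = []
nearDiagonal (suc m) = map (λ v → false ∷ true ∷ v) (diagonal m)
  ++ map (λ v → false ∷ false ∷ v) (nearDiagonal m) ++ map (λ v → true ∷ true ∷ v) (nearDiagonal m)

swapPairs : Vertex d → Vertex d
swapPairs []          = []
swapPairs (x ∷ [])    = x ∷ []
swapPairs (x ∷ y ∷ v) = y ∷ x ∷ swapPairs v

A₆ B₆ C₆ : List (Vertex 6)
A₆ = nearDiagonal 3
B₆ = map swapPairs A₆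
C₆ = diagonal 3

-- Rational values make the marginal conditions decidable by evaluation.
mass : Vertex 6 → Vertex 6 → ℚ
mass a b = if does (b ≟ swapPairs a) then ℤ.+ 1 / 12 else 0ℚ

middle : Vertex 6 → List (Vertex 6)
middle a = midpoints a (swapPairs a)

-- Finite checks in dimension 6

unique? : (S : List (Vertex d)) → Dec (Unique S)
unique? = DecUnique.unique? _≟_

A₆-unique : Unique A₆
A₆-unique = from-yes (unique? A₆)

B₆-unique : Unique B₆
B₆-unique = from-yes (unique? B₆)

C₆-unique : Unique C₆
C₆-unique = from-yes (unique? C₆)

A₆-B₆-distance : All (λ a → All (λ b → 4 ≤ hamming a b ℕ.* hamming a b) B₆) A₆
A₆-B₆-distance = from-yes (All.all? (λ a → All.all? (λ b → 4 ℕ.≤? hamming a b ℕ.* hamming a b) B₆) A₆)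

swapPairs-distance : All (λ a → hamming a (swapPairs a) ≡ 2) A₆
swapPairs-distance = from-yes (All.all? (λ a → hamming a (swapPairs a) ℕ.≟ 2) A₆)

mass-source : All (λ a → sumℚ B₆ (mass a) ≡ ℤ.+ 1 / 12) A₆
mass-source = from-yes (All.all? (λ a → sumℚ B₆ (mass a) ℚ.≟ ℤ.+ 1 / 12) A₆)

mass-target : All (λ b → sumℚ A₆ (λ a → mass a b) ≡ ℤ.+ 1 / 12) B₆
mass-target = from-yes (All.all? (λ b → sumℚ A₆ (λ a → mass a b) ℚ.≟ ℤ.+ 1 / 12) B₆)

length-middle : All (λ a → length (middle a) ≡ 2) A₆
length-middle = from-yes (All.all? (λ a → length (middle a) ℕ.≟ 2) A₆)

middle⊆C₆ : All (λ a → All (_∈ C₆) (middle a)) A₆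
middle⊆C₆ = from-yes (All.all? (λ a → All.all? (_∈? C₆) (middle a)) A₆)

-- A vertex of `C₆` is a midpoint for three a, one for each pair of coordinates that can be changed
-- to 01. Each sends half of 1/12, and 3/24 = 1/8.
sum-middle : All (λ c → sumℚ A₆ (λ a → ((ℤ.+ 1 / 24) on middle a) c) ≡ ℤ.+ 1 / 8) C₆
sum-middle = from-yes (All.all? (λ c → sumℚ A₆ (λ a → ((ℤ.+ 1 / 24) on middle a) c) ℚ.≟ ℤ.+ 1 / 8) C₆)

mass-swapPairs : ∀ a → mass a (swapPairs a) ≡ ℤ.+ 1 / 12
mass-swapPairs a = cong (if_then ℤ.+ 1 / 12 else 0ℚ) (dec-true (swapPairs a ≟ swapPairs a) refl)

mass-zero : ∀ {a b} → b ≢ swapPairs a → mass a b ≡ 0ℚ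
mass-zero {a} {b} b≢ = cong (if_then ℤ.+ 1 / 12 else 0ℚ) (dec-false (b ≟ swapPairs a) b≢)

mass-nonNeg : ∀ a b → 0ℚ ≤ℚ mass a b
mass-nonNeg a b with does (b ≟ swapPairs a)
... | true  = ℚ.nonNegative⁻¹ (ℤ.+ 1 / 12)
... | false = ℚ.≤-refl

-- The example in dimension k + 6

module Example (k : ℕ) where

  A B : VertexSet (k ℕ.+ 6)
  A = record { elements = map (pad k) A₆ ; unique = Unique.map⁺ (pad-injective k) A₆-unique ; nonempty = λ () }
  B = record { elements = map (pad k) B₆ ; unique = Unique.map⁺ (pad-injective k) B₆-unique ; nonempty = λ () }

  C : List (Vertex (k ℕ.+ 6))
  C = map (pad k) C₆

  -- A plan is defined on all vertices; dropping k coordinates recovers the original vertices from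
  -- padded ones.
  τ : Plan (k ℕ.+ 6)
  τ α β = fromℚ (mass (Vec.drop k α) (Vec.drop k β))

  τ-pad : ∀ a b n → seq (τ (pad k a) (pad k b)) n ≡ mass a b
  τ-pad a b n = cong₂ mass (drop-pad k a) (drop-pad k b)

  seq-uniform-A : ∀ v n → seq (uniform A v) n ≡ ((ℤ.+ 1 / 12) on elements A) v
  seq-uniform-A v n = seq-spread 1ℝ {elements A} v n refl

  seq-uniform-B : ∀ v n → seq (uniform B v) n ≡ ((ℤ.+ 1 / 12) on elements B) v
  seq-uniform-B v n = seq-spread 1ℝ {elements B} v n refl

  τ-isTransportation : IsTransportation A B τ
  τ-isTransportation = record
    { 0≤τ = λ {α} {β} _ _ → pointwise⇒≤ℝ {0ℝ} {τ α β} λ _ → mass-nonNeg (Vec.drop k α) (Vec.drop k β)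
    ; sourceMass = source
    ; targetMass = target
    }
    where
    open ≡-Reasoning
    source : ∀ {α} → α ∈ elements A → uniform A α ≃ℝ ∑ (elements B) (τ α)
    source α∈A with ∈-map⁻ (pad k) α∈A
    ... | a , a∈A₆ , refl = pointwise⇒≃ℝ {uniform A (pad k a)} {∑ (elements B) (τ (pad k a))} λ n → begin
      seq (uniform A (pad k a)) n                            ≡⟨ seq-uniform-A (pad k a) n ⟩
      ((ℤ.+ 1 / 12) on elements A) (pad k a)                 ≡⟨ on-∈ (ℤ.+ 1 / 12) α∈A ⟩
      ℤ.+ 1 / 12                                             ≡⟨ All.lookup mass-source a∈A₆ ⟨
      sumℚ B₆ (mass a)                                       ≡⟨ sum-cong {xs = B₆} (λ {b} _ → τ-pad a b n) ⟨
      sumℚ B₆ (λ b → seq (τ (pad k a) (pad k b)) n)          ≡⟨ sum-map (pad k) B₆ (λ β → seq (τ (pad k a) β) n) ⟨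
      sumℚ (elements B) (λ β → seq (τ (pad k a) β) n)        ≡⟨ seq-∑ (elements B) (τ (pad k a)) n ⟨
      seq (∑ (elements B) (τ (pad k a))) n                   ∎
    target : ∀ {β} → β ∈ elements B → uniform B β ≃ℝ ∑ (elements A) (λ α → τ α β)
    target β∈B with ∈-map⁻ (pad k) β∈B
    ... | b , b∈B₆ , refl = pointwise⇒≃ℝ {uniform B (pad k b)} {∑ (elements A) (λ α → τ α (pad k b))} λ n → begin
      seq (uniform B (pad k b)) n                            ≡⟨ seq-uniform-B (pad k b) n ⟩
      ((ℤ.+ 1 / 12) on elements B) (pad k b)                 ≡⟨ on-∈ (ℤ.+ 1 / 12) β∈B ⟩
      ℤ.+ 1 / 12                                             ≡⟨ All.lookup mass-target b∈B₆ ⟨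
      sumℚ A₆ (λ a → mass a b)                               ≡⟨ sum-cong {xs = A₆} (λ {a} _ → τ-pad a b n) ⟨
      sumℚ A₆ (λ a → seq (τ (pad k a) (pad k b)) n)          ≡⟨ sum-map (pad k) A₆ (λ α → seq (τ α (pad k b)) n) ⟨
      sumℚ (elements A) (λ α → seq (τ α (pad k b)) n)        ≡⟨ seq-∑ (elements A) (λ α → τ α (pad k b)) n ⟨
      seq (∑ (elements A) (λ α → τ α (pad k b))) n           ∎

  τ-isOptimal : IsOptimal A B τ
  τ-isOptimal = constant-distance-optimal {A = A} {B} {τ} 4 τ-isTransportation 4≤ supp
    where
    4≤ : ∀ {α β} → α ∈ elements A → β ∈ elements B → 4 ≤ hamming α β ℕ.* hamming α β
    4≤ α∈A β∈B with ∈-map⁻ (pad k) α∈A | ∈-map⁻ (pad k) β∈B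
    ... | a , a∈A₆ , refl | b , b∈B₆ , refl = subst (λ h → 4 ≤ h ℕ.* h) (sym (hamming-pad k a b))
      (All.lookup (All.lookup A₆-B₆-distance a∈A₆) b∈B₆)
    supp : ∀ {α β} → α ∈ elements A → β ∈ elements B → ∀ n →
           seq (τ α β *ℝ fromℕ (hamming α β ℕ.* hamming α β)) n ≡ seq (τ α β *ℝ fromℕ 4) n
    supp α∈A β∈B n with ∈-map⁻ (pad k) α∈A | ∈-map⁻ (pad k) β∈B
    ... | a , a∈A₆ , refl | b , b∈B₆ , refl with b ≟ swapPairs a
    -- On the graph of `swapPairs` the squared distance is 4; off it, both products are 0.
    ... | yes refl = cong (λ h → seq (τ (pad k a) (pad k b)) n * (ℤ.+ (h ℕ.* h) / 1))
      (trans (hamming-pad k a b) (All.lookup swapPairs-distance a∈A₆))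
    ... | no  b≢   = trans (zero* (hamming (pad k a) (pad k b) ℕ.* hamming (pad k a) (pad k b))) (sym (zero* 4))
      where
      zero* : ∀ h → seq (τ (pad k a) (pad k b)) n * (ℤ.+ h / 1) ≡ 0ℚ
      zero* h = trans (cong (_* (ℤ.+ h / 1)) (trans (τ-pad a b n) (mass-zero b≢))) (ℚ.*-zeroˡ (ℤ.+ h / 1))

  -- All the mass of a goes to `swapPairs a`, so one β survives in the sum, and its two midpoints
  -- receive 1/12 * 1/2 = 1/24 each.
  seq-spread-midpoints : ∀ {a} → a ∈ A₆ → ∀ γ n →
    seq (∑ (elements B) (λ β → spread (τ (pad k a) β) (midpoints (pad k a) β) γ)) n ≡
    ((ℤ.+ 1 / 24) on map (pad k) (middle a)) γ
  seq-spread-midpoints {a} a∈A₆ γ n = begin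
    seq (∑ (elements B) (λ β → spread (τ (pad k a) β) (midpoints (pad k a) β) γ)) n
      ≡⟨ seq-∑ (elements B) share n ⟩
    sumℚ (elements B) (λ β → seq (share β) n)
      ≡⟨ sum-map (pad k) B₆ (λ β → seq (share β) n) ⟩
    sumℚ B₆ (λ b → seq (share (pad k b)) n)
      ≡⟨ sum-single (λ b → seq (share (pad k b)) n) B₆-unique (∈-map⁺ swapPairs a∈A₆) share-zero ⟩
    seq (share (pad k (swapPairs a))) n
      ≡⟨ seq-spread (τ (pad k a) (pad k (swapPairs a))) {midpoints (pad k a) (pad k (swapPairs a))} γ n length≡2 ⟩
    ((seq (τ (pad k a) (pad k (swapPairs a))) n * ½) on midpoints (pad k a) (pad k (swapPairs a))) γ
      ≡⟨ cong₂ (λ q S → ((q * ½) on S) γ)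
           (trans (τ-pad a (swapPairs a) n) (mass-swapPairs a)) (midpoints-pad k a (swapPairs a)) ⟩
    ((ℤ.+ 1 / 24) on map (pad k) (middle a)) γ ∎
    where
    open ≡-Reasoning
    share : Vertex (k ℕ.+ 6) → ℝ
    share β = spread (τ (pad k a) β) (midpoints (pad k a) β) γ
    share-zero : ∀ {b} → b ≢ swapPairs a → seq (share (pad k b)) n ≡ 0ℚ
    share-zero {b} b≢ = seq-spread-zero (τ (pad k a) (pad k b)) (midpoints (pad k a) (pad k b)) γ n
      (trans (τ-pad a b n) (mass-zero b≢))
    length≡2 : length (midpoints (pad k a) (pad k (swapPairs a))) ≡ 2
    length≡2 = trans (cong length (midpoints-pad k a (swapPairs a)))
      (trans (length-map (pad k) (middle a)) (All.lookup length-middle a∈A₆))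

  -- For γ in C the sum descends to dimension 6, where `sum-middle` evaluates it. Any other γ is
  -- missed by every list of midpoints, since these lie in C by `middle⊆C₆`.
  seq-midpointMeasure : ∀ γ n → seq (midpointMeasure A B τ γ) n ≡ ((ℤ.+ 1 / 8) on C) γ
  seq-midpointMeasure γ n = begin
    seq (midpointMeasure A B τ γ) n
      ≡⟨ seq-∑ (elements A) received n ⟩
    sumℚ (elements A) (λ α → seq (received α) n)
      ≡⟨ sum-map (pad k) A₆ (λ α → seq (received α) n) ⟩
    sumℚ A₆ (λ a → seq (received (pad k a)) n)
      ≡⟨ sum-cong {xs = A₆} (λ a∈A₆ → seq-spread-midpoints a∈A₆ γ n) ⟩
    sumℚ A₆ (λ a → ((ℤ.+ 1 / 24) on map (pad k) (middle a)) γ)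
      ≡⟨ total (γ ∈? C) ⟩
    ((ℤ.+ 1 / 8) on C) γ ∎
    where
    open ≡-Reasoning
    received : Vertex (k ℕ.+ 6) → ℝ
    received α = ∑ (elements B) (λ β → spread (τ α β) (midpoints α β) γ)
    total : Dec (γ ∈ C) →
            sumℚ A₆ (λ a → ((ℤ.+ 1 / 24) on map (pad k) (middle a)) γ) ≡ ((ℤ.+ 1 / 8) on C) γ
    total (yes γ∈C) with ∈-map⁻ (pad k) γ∈C
    ... | c , c∈C₆ , refl = begin
      sumℚ A₆ (λ a → ((ℤ.+ 1 / 24) on map (pad k) (middle a)) (pad k c))
        ≡⟨ sum-cong {xs = A₆} (λ {a} _ → on-preimage (ℤ.+ 1 / 24) (pad-injective k) (middle a) c) ⟩
      sumℚ A₆ (λ a → ((ℤ.+ 1 / 24) on middle a) c)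
        ≡⟨ All.lookup sum-middle c∈C₆ ⟩
      ℤ.+ 1 / 8
        ≡⟨ on-∈ (ℤ.+ 1 / 8) γ∈C ⟨
      ((ℤ.+ 1 / 8) on C) (pad k c) ∎
    total (no γ∉C) = trans
      (sum-zero {xs = A₆} λ a∈A₆ → on-∉ (ℤ.+ 1 / 24) λ γ∈ → let (u , u∈ , γ≡) = ∈-map⁻ (pad k) γ∈ in
        γ∉C (subst (_∈ C) (sym γ≡) (∈-map⁺ (pad k) (All.lookup (All.lookup middle⊆C₆ a∈A₆) u∈))))
      (sym (on-∉ (ℤ.+ 1 / 8) γ∉C))

  μ-zeroOrPositive : ZeroOrPositive (midpointMeasure A B τ)
  μ-zeroOrPositive γ = constant-zeroOrPositive {midpointMeasure A B τ γ} (seq-midpointMeasure γ)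
    (on-nonNeg (ℚ.nonNegative⁻¹ (ℤ.+ 1 / 8)) C γ)

  entropy-decreases : entropy (midpointMeasure A B τ) μ-zeroOrPositive <ℝ
    fromℚ ½ *ℝ (entropy (uniform A) (uniform-zeroOrPositive A) +ℝ
                entropy (uniform B) (uniform-zeroOrPositive B))
  entropy-decreases = <ℝ-mean
    (entropy (midpointMeasure A B τ) μ-zeroOrPositive)
    (entropy (uniform A) (uniform-zeroOrPositive A)) (entropy (uniform B) (uniform-zeroOrPositive B))
    {λ n → lnRecip n (ℤ.+ 1 / 8)} {λ n → lnRecip n (ℤ.+ 1 / 12)}
    gap (ℚ.positive⁻¹ gap)
    -- The `refl` here and in the next two applications evaluates the total mass: 8 * 1/8 = 1 and 12
    -- * 1/12 = 1.
    (seq-entropy {μ = midpointMeasure A B τ} {ℤ.+ 1 / 8} {C}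
      (Unique.map⁺ (pad-injective k) C₆-unique) refl seq-midpointMeasure μ-zeroOrPositive)
    (seq-entropy {μ = uniform A} {ℤ.+ 1 / 12} {elements A} (unique A) refl seq-uniform-A (uniform-zeroOrPositive A))
    (seq-entropy {μ = uniform B} {ℤ.+ 1 / 12} {elements B} (unique B) refl seq-uniform-B (uniform-zeroOrPositive B))
    (lnRecip-gap (ℤ.+ 1 / 8) (ℤ.+ 1 / 12) {gap} (ℚ.nonNegative⁻¹ (möbiusRecip (ℤ.+ 1 / 8)))
      (from-yes (möbiusRecip (ℤ.+ 1 / 8) ℚ.≤? möbiusRecip (ℤ.+ 1 / 12))) refl)
    where
    -- At r = 12 and r = 8 the quotient (r - 1) / (r + 1) is 11/13 and 7/9, so the gap is 2 * 8/117
    -- = 16/117.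
    gap : ℚ
    gap = ℤ.+ 2 / 1 * (möbiusRecip (ℤ.+ 1 / 12) + - möbiusRecip (ℤ.+ 1 / 8))

-- The conclusion as a family over d, so that it can be transported along (d ∸ 6) + 6 = d.
Counterexample : ℕ → Set
Counterexample d =
  Σ[ A ∈ VertexSet d ] Σ[ B ∈ VertexSet d ] Σ[ τ ∈ Plan d ]
    (IsOptimal A B τ ×
     (Σ[ z ∈ ZeroOrPositive (midpointMeasure A B τ) ]
       entropy (midpointMeasure A B τ) z <ℝ
         fromℚ ½ *ℝ (entropy (uniform A) (uniform-zeroOrPositive A) +ℝ
                     entropy (uniform B) (uniform-zeroOrPositive B))))

counterexample : ∀ k → Counterexample (k ℕ.+ 6)
counterexample k = A , B , τ , τ-isOptimal , μ-zeroOrPositive , entropy-decreases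
  where open Example k

mainTheorem9 : ∀ (d : ℕ) → 10 ≤ d →
    Σ[ A ∈ VertexSet d ] Σ[ B ∈ VertexSet d ] Σ[ τ ∈ Plan d ]
      (IsOptimal A B τ ×
       (Σ[ z ∈ ZeroOrPositive (midpointMeasure A B τ) ]
         entropy (midpointMeasure A B τ) z <ℝ
           fromℚ ½ *ℝ (entropy (uniform A) (uniform-zeroOrPositive A) +ℝ
                       entropy (uniform B) (uniform-zeroOrPositive B))))
mainTheorem9 d 10≤d =
  -- Here `ℕ.m≤n+m 6 4` is 6 ≤ 10, so d ∸ 6 coordinates of padding give dimension d.
  subst Counterexample (ℕ.m∸n+n≡m (ℕ.≤-trans (ℕ.m≤n+m 6 4) 10≤d)) (counterexample (d ℕ.∸ 6))
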